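{- Let $G$ be a $2$-tree-connected graph and let $f$ be a positive integer-valued function on $V(G)$. If for every $S\subseteq V(G)$, $$\tfrac{1}{2}\Omega_2(G\setminus S)\le \sum_{v\in S}\big(f(v)-\tfrac{3}{2}\big)+2,$$ then $G$ has a spanning closed trail meeting each vertex $v$ at most $f(v)$ times.
   Context: Graphs are finite, loopless, and may have multiple edges. A graph is $m$-tree-connected if it contains $m$ pairwise edge-disjoint spanning trees (a one-vertex graph is $m$-tree-connected). The $m$-tree-connected components of $G$ are its maximal induced $m$-tree-connected subgraphs; their vertex sets partition $V(G)$. For a partition $P$ of $V(G)$, $e_G(P)$ is the number of edges with ends in different parts. $\Omega_m(G)=m|P|-e_G(P)$ for $P$ the partition into vertex sets of the $m$-tree-connected components (and $\Omega_m=0$ for the graph with no vertices). $G\setminus S$ is obtained by deleting the vertices in $S$. A spanning closed trail meeting each vertex $v$ at most $f(v)$ times is a closed trail (no repeated edges) passing through every vertex and passing through each vertex $v$ at most $f(v)$ times. -}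

module Defs where

open import Data.Nat using (ℕ; zero; suc; _+_; _*_; _≤_)
open import Data.Nat.DivMod using (_mod_)
open import Data.Integer as ℤ using (ℤ; +_; _-_)
open import Data.Fin using (Fin; zero; suc; toℕ)
open import Data.Fin.Properties using (_≟_)
open import Data.Fin.Subset using (Subset; _∈_; _∉_; _⊆_; ∣_∣)
open import Data.Fin.Subset.Properties using (_∈?_)
open import Data.Vec using (tabulate)
open import Data.Bool using (Bool; true; false; _∧_; not; if_then_else_)
open import Data.Product using (Σ; ∃; _×_; _,_; proj₁; proj₂)
open import Data.Sum using (_⊎_)
open import Relation.Binary.PropositionalEquality using (_≡_; _≢_)
open import Relation.Nullary.Decidable using (⌊_⌋)
open import Function.Definitions using (Injective)

-- Finite loopless multigraphs: vertices Fin n, edges Fin m, each edge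
-- has an (unordered, stored as an ordered pair) pair of distinct ends.
-- Parallel edges are allowed (ends need not be injective).

record Graph : Set where
  field
    n        : ℕ
    m        : ℕ
    ends     : Fin m → Fin n × Fin n
    loopless : ∀ e → proj₁ (ends e) ≢ proj₂ (ends e)

module _ (G : Graph) where
  open Graph G

  Joins : Fin m → Fin n → Fin n → Set
  Joins e u v = ends e ≡ (u , v) ⊎ ends e ≡ (v , u)

  Inside : Subset n → Fin m → Set
  Inside X e = proj₁ (ends e) ∈ X × proj₂ (ends e) ∈ X

  data Reach (F : Subset m) : Fin n → Fin n → Set where
    here : ∀ {u} → Reach F u u
    step : ∀ {u w v} (e : Fin m) → e ∈ F → Joins e u w → Reach F w v → Reach F u v

  SpanningTree : Subset n → Subset m → Set
  SpanningTree X F =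
      (∀ e → e ∈ F → Inside X e)
    × (∀ u v → u ∈ X → v ∈ X → Reach F u v)
    × (∣ F ∣ + 1 ≡ ∣ X ∣)

  -- G[X] is k-tree-connected: k pairwise edge-disjoint spanning trees
  -- (note: forces X nonempty).
  TreeConnected : ℕ → Subset n → Set
  TreeConnected k X =
    Σ (Fin k → Subset m) λ T →
        (∀ i → SpanningTree X (T i))
      × (∀ i j → i ≢ j → ∀ e → e ∈ T i → e ∉ T j)

  Part : (X : Subset n) {c : ℕ} → (Fin n → Fin c) → Fin c → Subset n
  Part X lab i = tabulate λ v → ⌊ v ∈? X ⌋ ∧ ⌊ lab v ≟ i ⌋

  record ComponentPartition (k : ℕ) (X : Subset n) : Set where
    field
      parts   : ℕ
      label   : Fin n → Fin parts
      nonempty : ∀ i → ∃ λ v → v ∈ X × label v ≡ i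
      treeConn : ∀ i → TreeConnected k (Part X label i)
      maximal  : ∀ i (Y : Subset n) → Y ⊆ X → Part X label i ⊆ Y →
                 TreeConnected k Y → Y ⊆ Part X label i

  crossing : (X : Subset n) {c : ℕ} → (Fin n → Fin c) → ℕ
  crossing X lab = ∣ tabulate (λ e →
      ⌊ proj₁ (ends e) ∈? X ⌋ ∧ ⌊ proj₂ (ends e) ∈? X ⌋
      ∧ not ⌊ lab (proj₁ (ends e)) ≟ lab (proj₂ (ends e)) ⌋) ∣

  Ω : {k : ℕ} {X : Subset n} → ComponentPartition k X → ℤ
  Ω {k} {X} P = + (k * ComponentPartition.parts P)
                - + crossing X (ComponentPartition.label P)

  sumOver : Subset n → (Fin n → ℤ) → ℤ
  sumOver S g = go n (λ v → v) where
    go : (j : ℕ) → (Fin j → Fin n) → ℤ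
    go zero    ι = + 0
    go (suc j) ι = (if ⌊ ι zero ∈? S ⌋ then g (ι zero) else + 0)
                   ℤ.+ go j (λ x → ι (suc x))

  next : {k : ℕ} → Fin (suc k) → Fin (suc k)
  next {k} i = suc (toℕ i) mod suc k

  data ClosedTrail : Set where
    trivial : Fin n → ClosedTrail
    cyclic  : (k : ℕ) (vert : Fin (suc k) → Fin n) (edge : Fin (suc k) → Fin m) →
              Injective _≡_ _≡_ edge →
              (∀ i → Joins (edge i) (vert i) (vert (next i))) → ClosedTrail

  count : {j : ℕ} → (Fin j → Bool) → ℕ
  count p = ∣ tabulate p ∣

  visits : ClosedTrail → Fin n → ℕ
  visits (trivial w) v = count {1} λ _ → ⌊ w ≟ v ⌋
  visits (cyclic k vert edge _ _) v = count λ i → ⌊ vert i ≟ v ⌋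

  Spanning : ClosedTrail → Set
  Spanning T = ∀ v → 1 ≤ visits T v

{-# OPTIONS --safe #-}
-- By parity, it suffices to find edge-disjoint spanning trees T₁, T₂ whose union H
-- has degree at most 2 f(v) + 1 at every v: adding to T₁ an edge set in T₂ that makes
-- all degrees even gives a spanning connected Eulerian subgraph.
--
-- Choose H with the least total excess over 2 f + 1, and start from the set B of
-- vertices with deg ≥ 2 f + 1.  Call X tight if T₁ and T₂ both connect X inside X, and
-- v reducible if its degree can be lowered (without harming the others) by changing
-- H inside a tight set that avoids B; the vertices outside B are reducible.  If an edge
-- xy outside H joins two distinct tight classes of G ∖ B, the exchanges started by xy
-- sweep out a tight set that contains x and y, hence meets B, and each of its vertices
-- is an end of an edge that can be traded for xy.  So these vertices become reducible
-- and leave B.  When no such edge is left, B still contains every vertex of positive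
-- excess, by minimality; the tight classes are the 2-tree-connected components of
-- G ∖ B, and counting the edges of H contradicts the hypothesis for S = B.

module Submission where

open import Defs
open import Data.Nat using (ℕ; zero; suc; _+_; _*_; _∸_; _⊔_; _≤_; _<_; z≤n; s≤s; s≤s⁻¹; >-nonZero; parity)
open import Data.Nat.Properties hiding (_≟_; suc-injective)
import Data.Nat.Properties as ℕ
open import Data.Nat.Tactic.RingSolver using (solve-∀)
open import Data.Integer as ℤ using (ℤ)
import Data.Integer.Properties as ℤ
open import Data.Integer.Tactic.RingSolver using () renaming (solve-∀ to ℤ-solve-∀)
open import Data.Nat.DivMod using (_%_; m<n⇒m%n≡m; n%n≡0)
open import Data.Fin using (Fin; zero; suc; toℕ; fromℕ; fromℕ<; inject₁)
open import Data.Fin.Properties using (_≟_; any?; all?; suc-injective; toℕ-injective; toℕ-inject₁; toℕ-fromℕ; toℕ-fromℕ<; toℕ<n)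
open import Data.Fin.Subset using (Subset; _∈_; _∉_; _⊆_; _⊂_; _∪_; _∩_; _─_; ∁; ⁅_⁆; ⊤; ∣_∣; Nonempty; inside)
open import Data.Fin.Subset.Properties
open import Data.Vec using (tabulate; lookup; _∷_; here; there)
open import Data.Vec.Properties using (lookup∘tabulate; tabulate∘lookup; lookup⇒[]=; []=⇒lookup)
open import Data.Bool using (Bool; true; false; if_then_else_; _∧_; not)
open import Data.Maybe using (Maybe; just; nothing)
open import Data.Maybe.Properties using (≡-dec; just-injective)
open import Data.Product using (∃; _×_; _,_; proj₁; proj₂)
open import Data.Sum using (_⊎_; inj₁; inj₂; [_,_]′; swap)
open import Data.Empty using (⊥; ⊥-elim)
open import Data.Parity using (Parity; 0ℙ; 1ℙ)
import Data.Parity as ℙ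
import Data.Parity.Properties as ℙ
open import Data.Unit using (tt) renaming (⊤ to Unit)
open import Function using (_∘_; id)
open import Relation.Nullary using (¬_; Dec; yes; no; does; ¬?; _×-dec_; _⊎-dec_; contradiction)
open import Relation.Nullary.Decidable using (dec-true; ⌊_⌋; isYes≗does; ¬¬-excluded-middle; decidable-stable)
open import Relation.Unary using (Decidable)
open import Relation.Binary.Definitions using (DecidableEquality)
open import Relation.Binary.PropositionalEquality
open import Relation.Binary.Construct.Closure.ReflexiveTransitive as Star using (Star; ε; _◅_; _◅◅_)
open import Algebra.Properties.CommutativeMonoid.Sum +-0-commutativeMonoid
  using (sum; sum-cong-≗; ∑-distrib-+; ∑-comm)
open import Algebra.Properties.Semiring.Sum +-*-semiring using (*-distribˡ-sum; *-distribʳ-sum)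

-- The final count: let p be the number of classes and c the number of edges between them. Since
-- each tree has at most |B| - 1 edges inside a nonempty B, the degrees over B sum to at most 4|B| +
-- 2p - c - 4. The doubled hypothesis bounds 2p - c by 4 plus the sum of 2 f - 3 over B, which
-- leaves at most the sum of 2 f + 1. But every vertex of B has at least that degree, and one has
-- more. This is what the constants 3/2 and 2 are made for.
--
-- The obstacle before the edge xy can be added is that a unit of degree must be freed at x and at y
-- simultaneously, by two unrelated recolourings. They live in tight sets that avoid B. If these
-- sets met, their union would put x and y in one class; so they are disjoint, and both recolourings
-- can be carried out at once.
--
-- The argument by minimality is run under a double negation, with excluded middle for the classes
-- and for the vertices swept out. An actual colouring is recovered at the end by a finite search,
-- as connectedness and degree bounds are decidable.

⟦_⟧ : {A : Set} → Dec A → ℕ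
⟦ d ⟧ = if does d then 1 else 0

⟦⟧-yes : {A : Set} (d : Dec A) → A → ⟦ d ⟧ ≡ 1
⟦⟧-yes (yes _) _ = refl
⟦⟧-yes (no ¬a) a = contradiction a ¬a

⟦⟧-no : {A : Set} (d : Dec A) → ¬ A → ⟦ d ⟧ ≡ 0
⟦⟧-no (yes a) ¬a = contradiction a ¬a
⟦⟧-no (no _)  _  = refl

⟦⟧-mono : {A B : Set} (a : Dec A) (b : Dec B) → (A → B) → ⟦ a ⟧ ≤ ⟦ b ⟧
⟦⟧-mono (no _)  _ _ = z≤n
⟦⟧-mono (yes a) b f = ≤-reflexive (sym (⟦⟧-yes b (f a)))

⟦⟧-cong : {A B : Set} (a : Dec A) (b : Dec B) → (A → B) → (B → A) → ⟦ a ⟧ ≡ ⟦ b ⟧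
⟦⟧-cong a b f g = ≤-antisym (⟦⟧-mono a b f) (⟦⟧-mono b a g)

-- Finite sums, subsets, cardinalities and parity

sum-mono : ∀ {k} {f g : Fin k → ℕ} → (∀ i → f i ≤ g i) → sum f ≤ sum g
sum-mono {zero}  _ = z≤n
sum-mono {suc _} h = +-mono-≤ (h zero) (sum-mono (h ∘ suc))

sum-mono-< : ∀ {k} {f g : Fin k → ℕ} → (∀ i → f i ≤ g i) → ∀ i → f i < g i → sum f < sum g
sum-mono-< {suc _} h zero    l = +-mono-<-≤ l (sum-mono (h ∘ suc))
sum-mono-< {suc _} h (suc i) l = +-mono-≤-< (h zero) (sum-mono-< (h ∘ suc) i l)

sum-zero : ∀ {k} {f : Fin k → ℕ} → (∀ i → f i ≡ 0) → sum f ≡ 0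
sum-zero {zero}  _ = refl
sum-zero {suc _} h = cong₂ _+_ (h zero) (sum-zero (h ∘ suc))

sum-one : ∀ k → sum {k} (λ _ → 1) ≡ k
sum-one zero    = refl
sum-one (suc k) = cong suc (sum-one k)

≤-sum : ∀ {k} (f : Fin k → ℕ) i → f i ≤ sum f
≤-sum f zero    = m≤m+n _ _
≤-sum f (suc i) = ≤-trans (≤-sum (f ∘ suc) i) (m≤n+m _ _)

sum-δ* : ∀ {k} (e : Fin k) c → sum (λ x → ⟦ x ≟ e ⟧ * c) ≡ c
sum-δ* {suc k} zero    c = trans (cong₂ _+_ (+-identityʳ c) (sum-zero {k} (λ _ → refl))) (+-identityʳ c)
sum-δ* {suc k} (suc e) c = trans (sum-cong-≗ λ x → cong (_* c) (⟦⟧-cong (suc x ≟ suc e) (x ≟ e) suc-injective (cong suc))) (sum-δ* e c)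

sum-δ : ∀ {k} (e : Fin k) → sum (λ x → ⟦ x ≟ e ⟧) ≡ 1
sum-δ e = trans (sum-cong-≗ λ x → sym (*-identityʳ ⟦ x ≟ e ⟧)) (sum-δ* e 1)

sum-δ′ : ∀ {k} (e : Fin k) → sum (λ x → ⟦ e ≟ x ⟧) ≡ 1
sum-δ′ e = trans (sum-cong-≗ λ x → ⟦⟧-cong (e ≟ x) (x ≟ e) sym sym) (sum-δ e)

subset : ∀ {k} {P : Fin k → Set} → Decidable P → Subset k
subset P? = tabulate (does ∘ P?)

∈-subset⁺ : ∀ {k} {P : Fin k → Set} (P? : Decidable P) {v} → P v → v ∈ subset P?
∈-subset⁺ P? {v} p = lookup⇒[]= v (subset P?) (trans (lookup∘tabulate _ v) (dec-true (P? v) p))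

∈-subset⁻ : ∀ {k} {P : Fin k → Set} (P? : Decidable P) {v} → v ∈ subset P? → P v
∈-subset⁻ P? {v} v∈ with P? v in eq
... | yes p = p
... | no _ with () ← trans (sym ([]=⇒lookup v∈)) (trans (lookup∘tabulate _ v) (cong does eq))

card-tabulate : ∀ {k} (b : Fin k → Bool) → ∣ tabulate b ∣ ≡ sum (λ i → if b i then 1 else 0)
card-tabulate {zero}  b = refl
card-tabulate {suc k} b with b zero
... | true  = cong suc (card-tabulate (b ∘ suc))
... | false = card-tabulate (b ∘ suc)

card : ∀ {k} (X : Subset k) → ∣ X ∣ ≡ sum (λ v → ⟦ v ∈? X ⟧)
card X = trans (cong ∣_∣ (sym (tabulate∘lookup X))) (trans (card-tabulate (lookup X)) (sum-cong-≗ pt))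
  where
  pt : ∀ v → (if lookup X v then 1 else 0) ≡ ⟦ v ∈? X ⟧
  pt v with lookup X v in eq
  ... | true  = sym (⟦⟧-yes (v ∈? X) (lookup⇒[]= v X eq))
  ... | false = sym (⟦⟧-no (v ∈? X) λ v∈ → contradiction (trans (sym eq) ([]=⇒lookup v∈)) λ ())

card-∁ : ∀ {k} (X : Subset k) → ∣ X ∣ + sum (λ v → ⟦ v ∈? ∁ X ⟧) ≡ k
card-∁ {k} X = trans (cong (_+ sum (λ v → ⟦ v ∈? ∁ X ⟧)) (card X))
  (trans (sym (∑-distrib-+ (λ v → ⟦ v ∈? X ⟧) _)) (trans (sum-cong-≗ pt) (sum-one k)))
  where
  pt : ∀ v → ⟦ v ∈? X ⟧ + ⟦ v ∈? ∁ X ⟧ ≡ 1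
  pt v with v ∈? X
  ... | yes v∈ = cong suc (⟦⟧-no (v ∈? ∁ X) (x∈p⇒x∉∁p v∈))
  ... | no v∉  = ⟦⟧-yes (v ∈? ∁ X) (x∉p⇒x∈∁p v∉)

-- Supplies decisions for a whole finite family at once while the goal is `⊥`.
¬¬-∀ : ∀ {k} {P : Fin k → Set} → (∀ i → ¬ ¬ P i) → ¬ ¬ (∀ i → P i)
¬¬-∀ {zero}  h ¬all = ¬all λ ()
¬¬-∀ {suc k} h ¬all = h zero λ p → ¬¬-∀ (h ∘ suc) λ ps → ¬all λ { zero → p ; (suc i) → ps i }

-- A record rather than a function, so that the number can be inferred.
record Even (k : ℕ) : Set where
  constructor even
  field parity≡0 : parity k ≡ 0ℙ

even-+ : ∀ {a b} → Even a → Even b → Even (a + b)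
even-+ {a} {b} (even p) (even q) = even (trans (ℙ.+-homo-+ a b) (cong₂ ℙ._+_ p q))

even-double : ∀ a → Even (a + a)
even-double a = even (trans (ℙ.+-homo-+ a a) (ℙ.p+p≡0ℙ (parity a)))

even-cancel : ∀ {a} b → Even b → Even (a + b) → Even a
even-cancel {a} b (even p) (even q) = even (ℙ.+-cancelʳ-≡ (parity b) _ _ (trans (sym (ℙ.+-homo-+ a b)) (trans q (sym p))))

even-* : ∀ a {b} → Even b → Even (a * b)
even-* zero    _ = even refl
even-* (suc a) p = even-+ p (even-* a p)

even-sum : ∀ {k} {f : Fin k → ℕ} → (∀ i → Even (f i)) → Even (sum f)
even-sum {zero}  _ = even refl
even-sum {suc _} h = even-+ (h zero) (even-sum (h ∘ suc))

¬even-1 : ¬ Even 1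
¬even-1 (even ())

residue : Parity → ℕ
residue 0ℙ = 0
residue 1ℙ = 1

residue≤1 : ∀ p → residue p ≤ 1
residue≤1 0ℙ = z≤n
residue≤1 1ℙ = s≤s z≤n

even-residue : ∀ k → Even (residue (parity k) + k)
even-residue k with parity k in eq
... | 0ℙ = even eq
... | 1ℙ = even (trans (ℙ.+-homo-+ 1 k) (cong (1ℙ ℙ.+_) eq))

-- The integer sum of the hypothesis, turned into sums of natural numbers

partialSum : ∀ {N} → Subset N → (Fin N → ℤ) → (j : ℕ) → (Fin j → Fin N) → ℤ
partialSum S g zero    ι = ℤ.+ 0
partialSum S g (suc j) ι = (if ⌊ ι zero ∈? S ⌋ then g (ι zero) else ℤ.+ 0) ℤ.+ partialSum S g j (ι ∘ suc)

-- The loop inside sumOver has no name, so aux, whose type leaves it to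
-- unification, does the induction.  For that, with has to generalise the
-- number of steps while keeping the vertex type: writing the vertex type with
-- u′ instead of u hides it from with, although the two agree by η for the unit type.
module _ (Γ : Unit → Graph) (u u′ : Unit) (S : Subset (Graph.n (Γ u′))) (g : Fin (Graph.n (Γ u′)) → ℤ) where

  sumOver-partialSum : sumOver (Γ u) S g ≡ partialSum S g (Graph.n (Γ u)) id

  private
    aux : (j : ℕ) (ι : Fin j → Fin (Graph.n (Γ u′))) → _ ≡ partialSum S g j ι

    all : Fin (Graph.n (Γ u)) → Fin (Graph.n (Γ u′))
    all v = v

  sumOver-partialSum with Graph.n (Γ u) | all
  ... | j | ι = aux j ι

  aux zero    ι = refl
  aux (suc j) ι = cong (ℤ._+_ (if ⌊ ι zero ∈? S ⌋ then g (ι zero) else ℤ.+ 0)) (aux j (ι ∘ suc))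

partialSum-affine : ∀ {N} (S : Subset N) (f : Fin N → ℕ) j ι →
  partialSum S (λ v → ℤ.+ 2 ℤ.* ℤ.+ f v ℤ.- ℤ.+ 3) j ι ℤ.+ ℤ.+ sum (λ x → ⟦ ι x ∈? S ⟧ * 3) ≡ ℤ.+ sum (λ x → ⟦ ι x ∈? S ⟧ * (2 * f (ι x)))
partialSum-affine S f zero    ι = refl
partialSum-affine S f (suc j) ι with ι zero ∈? S
... | no _  = trans (cong (λ y → y ℤ.+ ℤ.+ sum (λ x → ⟦ ι (suc x) ∈? S ⟧ * 3)) (ℤ.+-identityˡ (partialSum S (λ v → ℤ.+ 2 ℤ.* ℤ.+ f v ℤ.- ℤ.+ 3) j (ι ∘ suc)))) (partialSum-affine S f j (ι ∘ suc))
... | yes _ = begin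
  (t ℤ.- ℤ.+ 3 ℤ.+ p) ℤ.+ (ℤ.+ 3 ℤ.+ c)  ≡⟨ shuffle t p c ⟩
  t ℤ.+ (p ℤ.+ c)                    ≡⟨ cong (ℤ._+_ t) (partialSum-affine S f j (ι ∘ suc)) ⟩
  t ℤ.+ ℤ.+ s                          ≡⟨ cong (λ y → y ℤ.+ ℤ.+ s) (sym (ℤ.pos-* 2 (f (ι zero)))) ⟩
  ℤ.+ (2 * f (ι zero) + s)             ≡⟨ cong (λ y → ℤ.+ (y + s)) (sym (+-identityʳ (2 * f (ι zero)))) ⟩
  ℤ.+ (2 * f (ι zero) + 0 + s)         ∎
  where
  open ≡-Reasoning
  t = ℤ.+ 2 ℤ.* ℤ.+ f (ι zero)
  p = partialSum S (λ v → ℤ.+ 2 ℤ.* ℤ.+ f v ℤ.- ℤ.+ 3) j (ι ∘ suc)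
  c = ℤ.+ sum (λ x → ⟦ ι (suc x) ∈? S ⟧ * 3)
  s = sum (λ x → ⟦ ι (suc x) ∈? S ⟧ * (2 * f (ι (suc x))))
  shuffle : ∀ t p c → (t ℤ.- ℤ.+ 3 ℤ.+ p) ℤ.+ (ℤ.+ 3 ℤ.+ c) ≡ t ℤ.+ (p ℤ.+ c)
  shuffle = ℤ-solve-∀

sumOver-affine : ∀ G (S : Subset (Graph.n G)) (f : Fin (Graph.n G) → ℕ) →
  sumOver G S (λ v → ℤ.+ 2 ℤ.* ℤ.+ f v ℤ.- ℤ.+ 3) ℤ.+ ℤ.+ sum (λ v → ⟦ v ∈? S ⟧ * 3) ≡ ℤ.+ sum (λ v → ⟦ v ∈? S ⟧ * (2 * f v))
sumOver-affine G S f = trans (cong (λ y → y ℤ.+ ℤ.+ sum (λ v → ⟦ v ∈? S ⟧ * 3)) (sumOver-partialSum (λ _ → G) tt tt S _)) (partialSum-affine S f (Graph.n G) id)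

module Multigraph (G : Graph) where
  open Graph G

  -- Walks and spanning trees

  Adj : (Fin m → Set) → Fin n → Fin n → Set
  Adj P u v = ∃ λ e → P e × Joins G e u v

  Conn : (Fin m → Set) → Fin n → Fin n → Set
  Conn P = Star (Adj P)

  Conn-sym : ∀ {P u v} → Conn P u v → Conn P v u
  Conn-sym = Star.reverse λ (e , p , j) → e , p , swap j

  Conn-map : ∀ {P Q : Fin m → Set} → (∀ {e} → P e → Q e) → ∀ {u v} → Conn P u v → Conn Q u v
  Conn-map f = Star.map λ (e , p , j) → e , f p , j

  edge : ∀ {P : Fin m → Set} {e u v} → P e → Joins G e u v → Conn P u v
  edge p j = (_ , p , j) ◅ ε

  Conn-bind : ∀ {P Q : Fin m → Set} → (∀ e → P e → Conn Q (proj₁ (ends e)) (proj₂ (ends e))) →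
              ∀ {u v} → Conn P u v → Conn Q u v
  Conn-bind {P} {Q} f = h Star.⋆
    where
    h : ∀ {u v} → Adj P u v → Conn Q u v
    h (e , p , inj₁ refl) = f e p
    h (e , p , inj₂ refl) = Conn-sym (f e p)

  infix 9 _∖_
  _∖_ : (Fin m → Set) → Fin m → Fin m → Set
  (P ∖ e) x = P x × x ≢ e

  Joins-ends : ∀ {e a b u w} → Joins G e a b → Joins G e u w → (u ≡ a × w ≡ b) ⊎ (u ≡ b × w ≡ a)
  Joins-ends (inj₁ p) (inj₁ q) with refl ← trans (sym p) q = inj₁ (refl , refl)
  Joins-ends (inj₁ p) (inj₂ q) with refl ← trans (sym p) q = inj₂ (refl , refl)
  Joins-ends (inj₂ p) (inj₁ q) with refl ← trans (sym p) q = inj₂ (refl , refl)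
  Joins-ends (inj₂ p) (inj₂ q) with refl ← trans (sym p) q = inj₁ (refl , refl)

  -- The three cases arise by cutting the walk after its last use of e.
  avoid : ∀ {P e a b} → Joins G e a b → ∀ {u v} → Conn P u v →
          Conn (P ∖ e) u v ⊎ Conn (P ∖ e) a v ⊎ Conn (P ∖ e) b v
  avoid j ε = inj₁ ε
  avoid {e = e} j (s ◅ c) with avoid j c
  ... | inj₂ r = inj₂ r
  avoid {e = e} j ((x , p , jx) ◅ c) | inj₁ r with x ≟ e
  ... | no x≢e = inj₁ ((x , (p , x≢e) , jx) ◅ r)
  ... | yes refl with Joins-ends j jx
  ...   | inj₁ (_ , refl) = inj₂ (inj₂ r)
  ...   | inj₂ (_ , refl) = inj₂ (inj₁ r)

  size : {P : Fin m → Set} → Decidable P → ℕ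
  size P? = sum λ e → ⟦ P? e ⟧

  infix 9 _∖?_
  _∖?_ : ∀ {P} → Decidable P → ∀ e → Decidable (P ∖ e)
  (P? ∖? e) x = P? x ×-dec ¬? (x ≟ e)

  size-∖ : ∀ {P} (P? : Decidable P) {e} → P e → size P? ≡ suc (size (P? ∖? e))
  size-∖ P? {e} p = trans (sum-cong-≗ pt) (trans (∑-distrib-+ (λ x → ⟦ x ≟ e ⟧) _) (cong (_+ size (P? ∖? e)) (sum-δ e)))
    where
    pt : ∀ x → ⟦ P? x ⟧ ≡ ⟦ x ≟ e ⟧ + ⟦ (P? ∖? e) x ⟧
    pt x with P? x | x ≟ e
    ... | yes _ | yes _    = refl
    ... | yes _ | no _     = refl
    ... | no _  | no _     = refl
    ... | no ¬p | yes refl = contradiction p ¬p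

  -- A graph with n vertices and k edges has at least n - k components, and `r` puts weight at least
  -- 1 on each of them. The other edge counts below (bridges, forests, connected sets) are instances
  -- of this one with a suitable `r`.
  dominating : ∀ {P} (P? : Decidable P) (r : Fin n → ℕ) →
               (∀ v → ∃ λ w → 1 ≤ r w × Conn P v w) → n ≤ size P? + sum r
  dominating P? r h = go (size P?) P? r refl h
    where
    go : ∀ k {P} (P? : Decidable P) r → size P? ≡ k →
         (∀ v → ∃ λ w → 1 ≤ r w × Conn P v w) → n ≤ k + sum r
    go zero {P} P? r eq h = subst (_≤ sum r) (sum-one n) (sum-mono λ v → pos v (h v))
      where
      none : ∀ {u v} → Conn P u v → u ≡ v
      none ε = refl
      none ((e , p , _) ◅ _) = contradiction (trans (sym (size-∖ P? p)) eq) λ ()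
      pos : ∀ v → ∃ (λ w → 1 ≤ r w × Conn P v w) → 1 ≤ r v
      pos v (w , l , c) with refl ← none c = l
    go (suc k) {P} P? r eq h with any? P?
    ... | no ¬p = contradiction (trans (sym eq) (sum-zero λ e → ⟦⟧-no (P? e) λ p → ¬p (e , p))) λ ()
    ... | yes (e , p) with h (proj₁ (ends e))
    ...   | w₀ , l₀ , c₀ = extend ([ inj₁ , id ]′ (avoid (inj₁ refl) c₀))
      where
      a = proj₁ (ends e)
      b = proj₂ (ends e)
      -- Deleting `e` creates at most one new component. One end of `e` still reaches `w₀`; the
      -- other end is `z` and receives an extra unit of weight.
      with-rep : ∀ z → (∀ y → y ≡ a ⊎ y ≡ b → y ≡ z ⊎ Conn (P ∖ e) y w₀) → n ≤ suc k + sum r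
      with-rep z hz = subst (n ≤_) (trans (cong (k +_) (trans (∑-distrib-+ (λ v → ⟦ v ≟ z ⟧) r) (cong (_+ sum r) (sum-δ z)))) (+-suc k _))
        (go k (P? ∖? e) (λ v → ⟦ v ≟ z ⟧ + r v) (ℕ.suc-injective (trans (sym (size-∖ P? p)) eq)) h′)
        where
        at : ∀ {v y} → Conn (P ∖ e) v y → y ≡ a ⊎ y ≡ b → ∃ λ w → 1 ≤ ⟦ w ≟ z ⟧ + r w × Conn (P ∖ e) v w
        at c y∈ with hz _ y∈
        ... | inj₁ refl = z , subst (1 ≤_) (cong (_+ r z) (sym (⟦⟧-yes (z ≟ z) refl))) (s≤s z≤n) , c
        ... | inj₂ c′ = w₀ , ≤-trans l₀ (m≤n+m _ _) , c ◅◅ c′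
        h′ : ∀ v → ∃ λ w → 1 ≤ ⟦ w ≟ z ⟧ + r w × Conn (P ∖ e) v w
        h′ v with h v
        ... | w , l , c with avoid (inj₁ refl) (Conn-sym c)
        ...   | inj₁ c′ = w , ≤-trans l (m≤n+m _ _) , Conn-sym c′
        ...   | inj₂ (inj₁ c′) = at (Conn-sym c′) (inj₁ refl)
        ...   | inj₂ (inj₂ c′) = at (Conn-sym c′) (inj₂ refl)
      extend : Conn (P ∖ e) a w₀ ⊎ Conn (P ∖ e) b w₀ → n ≤ suc k + sum r
      extend (inj₁ c) = with-rep b λ { _ (inj₁ refl) → inj₂ c ; _ (inj₂ eq) → inj₁ eq }
      extend (inj₂ c) = with-rep a λ { _ (inj₂ refl) → inj₂ c ; _ (inj₁ eq) → inj₁ eq }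

  -- If the ends stayed connected without `e`, then n - 2 edges would still connect all n vertices,
  -- against `dominating` with weight 1 at `a` alone.
  bridge : ∀ {P} (P? : Decidable P) → (∀ u v → Conn P u v) → size P? + 1 ≡ n →
           ∀ {e a b} → P e → Joins G e a b → ¬ Conn (P ∖ e) a b
  bridge {P} P? con eq {e} {a} {b} p j ab = 1+n≰n (≤-trans (≤-reflexive (trans (cong (_+ 1) (sym (size-∖ P? p))) eq))
      (subst (λ t → n ≤ size (P? ∖? e) + t) (sum-δ a) (dominating (P? ∖? e) (λ v → ⟦ v ≟ a ⟧) h)))
    where
    h : ∀ v → ∃ λ w → 1 ≤ ⟦ w ≟ a ⟧ × Conn (P ∖ e) v w
    h v = a , ≤-reflexive (sym (⟦⟧-yes (a ≟ a) refl)) ,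
      [ Conn-sym , [ Conn-sym , (λ c → Conn-sym (ab ◅◅ c)) ]′ ]′ (avoid j (con a v))

  -- In a tree these are the edges of the path from `u` to `v`, hence exactly those that can be
  -- traded for a new edge `uv`.
  Sep : (Fin m → Set) → Fin n → Fin n → Fin m → Set
  Sep P u v e = P e × ¬ Conn (P ∖ e) u v

  -- Induction along the walk. If `w` reaches `v` without the first edge `e`, then `e` separates `u`
  -- from `v`, and so does whatever separates `w` from `v` (`stay`). If instead `u` reaches `v`
  -- without `e`, the walk from `w` returns through `e`, and the part after its last use of `e`
  -- already starts at `u` (`shortcut`).
  separating-path : ∀ {P} → (∀ {e a b} → P e → Joins G e a b → ¬ Conn (P ∖ e) a b) →
                    ∀ {u v} → Conn P u v → Conn (Sep P u v) u v
  separating-path br ε = ε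
  separating-path {P} br {u} {v} (_◅_ {j = w} (e , p , j) c) = [ stay , [ shortcut , stay ]′ ]′ (avoid j c)
    where
    rest : Conn (Sep P w v) w v
    rest = separating-path br c
    stay : Conn (P ∖ e) w v → Conn (Sep P u v) u v
    stay wv = (e , (p , λ uv → br p j (uv ◅◅ Conn-sym wv)) , j) ◅
      Conn-map (λ (p′ , sep) → p′ , λ uv → sep ((e , (p , λ { refl → sep wv }) , swap j) ◅ uv)) rest
    shortcut : Conn (P ∖ e) u v → Conn (Sep P u v) u v
    shortcut uv = [ back , [ Conn-map keep , back ]′ ]′ (avoid j rest)
      where
      back : Conn (Sep P w v ∖ e) w v → Conn (Sep P u v) u v
      back wv = ⊥-elim (br p j (uv ◅◅ Conn-sym (Conn-map (λ ((p′ , _) , ne) → p′ , ne) wv)))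
      keep : ∀ {x} → (Sep P w v ∖ e) x → Sep P u v x
      keep ((p′ , sep) , ne) = p′ , λ uv → sep ((e , (p , ne ∘ sym) , swap j) ◅ uv)

  -- Exchanges between two disjoint spanning trees

  _≟ᶜ_ : DecidableEquality (Maybe (Fin 2))
  _≟ᶜ_ = ≡-dec _≟_

  -- Two edge-disjoint edge sets; nothing marks the unused edges.
  Colouring : Set
  Colouring = Fin m → Maybe (Fin 2)

  Col : Colouring → Fin 2 → Fin m → Set
  Col χ i e = χ e ≡ just i

  Col? : ∀ χ i → Decidable (Col χ i)
  Col? χ i e = χ e ≟ᶜ just i

  Trees : Colouring → Set
  Trees χ = ∀ i → (∀ u v → Conn (Col χ i) u v) × size (Col? χ i) + 1 ≡ n

  inc : Fin m → Fin n → ℕ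
  inc e v = ⟦ proj₁ (ends e) ≟ v ⟧ + ⟦ proj₂ (ends e) ≟ v ⟧

  used : Maybe (Fin 2) → ℕ
  used nothing  = 0
  used (just _) = 1

  -- Covers both the size of a colour and the degree at a vertex, so that exchanges and grafts need
  -- one computation each.
  weight : (Fin m → Maybe (Fin 2) → ℕ) → Colouring → ℕ
  weight g χ = sum λ e → g e (χ e)

  deg : Colouring → Fin n → ℕ
  deg χ v = weight (λ e c → used c * inc e v) χ

  exch : Colouring → Fin m → Fin m → Fin 2 → Colouring
  exch χ e e′ i x = if does (x ≟ e′) then nothing else if does (x ≟ e) then just i else χ x

  exch-out : ∀ χ e e′ i → exch χ e e′ i e′ ≡ nothing
  exch-out χ e e′ i with e′ ≟ e′
  ... | yes _ = refl
  ... | no ne = contradiction refl ne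

  exch-in : ∀ χ {e e′} i → e ≢ e′ → exch χ e e′ i e ≡ just i
  exch-in χ {e} {e′} i ne with e ≟ e′ | e ≟ e
  ... | yes eq | _     = contradiction eq ne
  ... | no _   | yes _ = refl
  ... | no _   | no n  = contradiction refl n

  exch-other : ∀ χ {e e′} i {x} → x ≢ e → x ≢ e′ → exch χ e e′ i x ≡ χ x
  exch-other χ {e} {e′} i {x} ne ne′ with x ≟ e′ | x ≟ e
  ... | yes eq | _      = contradiction eq ne′
  ... | no _   | yes eq = contradiction eq ne
  ... | no _   | no _   = refl

  free≢ : ∀ (χ : Colouring) {e e′ i} → χ e ≡ nothing → χ e′ ≡ just i → e ≢ e′
  free≢ χ p q refl with () ← trans (sym p) q

  exch-weight : ∀ g χ {e e′} i → χ e ≡ nothing → χ e′ ≡ just i →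
    weight g (exch χ e e′ i) + (g e nothing + g e′ (just i)) ≡ weight g χ + (g e (just i) + g e′ nothing)
  exch-weight g χ {e} {e′} i free taken = begin
    weight g (exch χ e e′ i) + (g e nothing + g e′ (just i))
      ≡⟨ cong₂ (λ c c′ → weight g (exch χ e e′ i) + (g e c + g e′ c′)) free taken ⟨
    weight g (exch χ e e′ i) + (g e (χ e) + g e′ (χ e′))
      ≡⟨ cong (weight g (exch χ e e′ i) +_) (point-mass (g e (χ e)) (g e′ (χ e′))) ⟨
    weight g (exch χ e e′ i) + sum (λ x → ⟦ x ≟ e ⟧ * g e (χ e) + ⟦ x ≟ e′ ⟧ * g e′ (χ e′))
      ≡⟨ ∑-distrib-+ (λ x → g x (exch χ e e′ i x)) _ ⟨
    sum (λ x → g x (exch χ e e′ i x) + (⟦ x ≟ e ⟧ * g e (χ e) + ⟦ x ≟ e′ ⟧ * g e′ (χ e′)))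
      ≡⟨ sum-cong-≗ pt ⟩
    sum (λ x → g x (χ x) + (⟦ x ≟ e ⟧ * g e (just i) + ⟦ x ≟ e′ ⟧ * g e′ nothing))
      ≡⟨ ∑-distrib-+ (λ x → g x (χ x)) _ ⟩
    weight g χ + sum (λ x → ⟦ x ≟ e ⟧ * g e (just i) + ⟦ x ≟ e′ ⟧ * g e′ nothing)
      ≡⟨ cong (weight g χ +_) (point-mass (g e (just i)) (g e′ nothing)) ⟩
    weight g χ + (g e (just i) + g e′ nothing) ∎
    where
    open ≡-Reasoning
    ne = free≢ χ free taken
    point-mass : ∀ a b → sum (λ x → ⟦ x ≟ e ⟧ * a + ⟦ x ≟ e′ ⟧ * b) ≡ a + b
    point-mass a b = trans (∑-distrib-+ (λ x → ⟦ x ≟ e ⟧ * a) _) (cong₂ _+_ (sum-δ* e a) (sum-δ* e′ b))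
    shuffle′ : ∀ a b → a + (b + 0) ≡ b + (a + 0)
    shuffle′ = solve-∀
    pt : ∀ x → g x (exch χ e e′ i x) + (⟦ x ≟ e ⟧ * g e (χ e) + ⟦ x ≟ e′ ⟧ * g e′ (χ e′)) ≡
               g x (χ x) + (⟦ x ≟ e ⟧ * g e (just i) + ⟦ x ≟ e′ ⟧ * g e′ nothing)
    pt x with x ≟ e′ | x ≟ e
    ... | yes refl | yes refl = contradiction refl ne
    ... | yes refl | no _     = shuffle′ (g x nothing) (g x (χ x))
    ... | no _     | yes refl = shuffle (g x (just i)) (g x (χ x))
      where
      shuffle : ∀ a b → a + (b + 0 + 0) ≡ b + (a + 0 + 0)
      shuffle = solve-∀
    ... | no _     | no _     = refl

  module Exchanges {χ₀ : Colouring} (T₀ : Trees χ₀) {f : Fin m} (f-free : χ₀ f ≡ nothing) where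

    -- χ is reached from χ₀ by a chain of exchanges, the edges used by χ₀ and f
    -- being those used by χ and e.
    data Reached : Colouring → Fin m → Set where
      start : Reached χ₀ f
      extend  : ∀ {χ e e′} i → Reached χ e →
              Sep (Col χ i) (proj₁ (ends e)) (proj₂ (ends e)) e′ → Reached (exch χ e e′ i) e′

    -- The edges that some chain of exchanges leaves out, among them `f` itself.
    D : Fin m → Set
    D e = ∃ λ χ → Reached χ e

    reached-free : ∀ {χ e} → Reached χ e → χ e ≡ nothing
    reached-free start = f-free
    reached-free (extend {χ} {e} {e′} i r _) = exch-out χ e e′ i

    -- Without `e′`, colour `i` falls into two sides. Both the ends of `e′` and the ends of `e` lie
    -- on different sides, so `e` rejoins them (`around`). One edge enters and one leaves, so the
    -- sizes stay the same.
    reached-trees : ∀ {χ e} → Reached χ e → Trees χ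
    reached-trees start = T₀
    reached-trees (extend {χ} {e} {e′} i r (p , sep)) j = (λ u v → Conn-bind reroute (proj₁ (T j) u v)) , trans (cong (_+ 1) (+-cancelʳ-≡ _ _ _ sizes)) (proj₂ (T j))
      where
      T = reached-trees r
      free = reached-free r
      ne : e ≢ e′
      ne = free≢ χ free p
      χ′ = exch χ e e′ i
      sizes : size (Col? χ′ j) + (⟦ just i ≟ᶜ just j ⟧ + 0) ≡ size (Col? χ j) + (⟦ just i ≟ᶜ just j ⟧ + 0)
      sizes = trans (cong (size (Col? χ′ j) +_) (+-identityʳ _)) (exch-weight (λ _ c → ⟦ c ≟ᶜ just j ⟧) χ i free p)
      keep : ∀ {x} → (Col χ j ∖ e′) x → Col χ′ j x
      keep (q , x≢e′) = trans (exch-other χ i (λ { refl → free≢ χ free q refl }) x≢e′) q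
      a = proj₁ (ends e′)
      b = proj₂ (ends e′)
      u = proj₁ (ends e)
      v = proj₂ (ends e)
      around : Conn (Col χ i ∖ e′) a v ⊎ Conn (Col χ i ∖ e′) b v → Conn (Col χ i ∖ e′) a u ⊎ Conn (Col χ i ∖ e′) b u →
               i ≡ j → Conn (Col χ′ j) a b
      around (inj₁ av) (inj₁ au) _ = ⊥-elim (sep (Conn-sym au ◅◅ av))
      around (inj₂ bv) (inj₂ bu) _ = ⊥-elim (sep (Conn-sym bu ◅◅ bv))
      around (inj₁ av) (inj₂ bu) refl = Conn-map keep av ◅◅ edge (exch-in χ i ne) (inj₂ refl) ◅◅ Conn-sym (Conn-map keep bu)
      around (inj₂ bv) (inj₁ au) refl = Conn-map keep au ◅◅ edge (exch-in χ i ne) (inj₁ refl) ◅◅ Conn-sym (Conn-map keep bv)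
      split : ∀ {y z} → ¬ Conn (Col χ i ∖ e′) y z → Conn (Col χ i ∖ e′) a z ⊎ Conn (Col χ i ∖ e′) b z
      split {y} {z} ¬yz = [ ⊥-elim ∘ ¬yz , id ]′ (avoid (inj₁ refl) (proj₁ (T i) y z))
      reroute : ∀ x → Col χ j x → Conn (Col χ′ j) (proj₁ (ends x)) (proj₂ (ends x))
      reroute x q with x ≟ e′
      ... | no x≢e′ = edge (keep (q , x≢e′)) (inj₁ refl)
      ... | yes refl = around (split sep) (split (sep ∘ Conn-sym)) (just-injective (trans (sym p) q))

    reached-bridges : ∀ {χ e} → Reached χ e → ∀ i {x a b} → Col χ i x → Joins G x a b → ¬ Conn (Col χ i ∖ x) a b
    reached-bridges {χ} r i = bridge (Col? χ i) (proj₁ (reached-trees r i)) (proj₂ (reached-trees r i))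

    _∩D : (Fin m → Set) → Fin m → Set
    (P ∩D) e = P e × D e

    -- Each edge of the tree path between the ends of `e` can be exchanged for `e`, and so belongs
    -- to `D`.
    ends-linked : ∀ {χ e} → Reached χ e → ∀ i → Conn (Col χ i ∩D) (proj₁ (ends e)) (proj₂ (ends e))
    ends-linked r i = Conn-map (λ s → proj₁ s , _ , extend i r s)
      (separating-path (reached-bridges r i) (proj₁ (reached-trees r i) _ _))

    -- An exchange does not change which vertices are linked by `D`-edges of colour `i`: the edge
    -- that came in is replaced by the tree path between its ends, which lies in `D`. `from-start`
    -- does the same for the edge that went out.
    to-start : ∀ {χ e} → Reached χ e → ∀ i {u v} → Conn (Col χ i ∩D) u v → Conn (Col χ₀ i ∩D) u v
    to-start start i = id
    to-start (extend {χ} {e} {e′} j r (p , sep)) i = to-start r i ∘ Conn-bind back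
      where
      back : ∀ x → (Col (exch χ e e′ j) i ∩D) x → Conn (Col χ i ∩D) (proj₁ (ends x)) (proj₂ (ends x))
      back x (q , d) with x ≟ e | x ≟ e′
      ... | yes refl | _ = ends-linked r i
      ... | no _ | yes refl with () ← q
      ... | no _ | no _ = edge (q , d) (inj₁ refl)

    from-start : ∀ {χ e} → Reached χ e → ∀ i {u v} → Conn (Col χ₀ i ∩D) u v → Conn (Col χ i ∩D) u v
    from-start start i = id
    from-start (extend {χ} {e} {e′} j r (p , sep)) i = Conn-bind forth ∘ from-start r i
      where
      forth : ∀ x → (Col χ i ∩D) x → Conn (Col (exch χ e e′ j) i ∩D) (proj₁ (ends x)) (proj₂ (ends x))
      forth x (q , d) with x ≟ e | x ≟ e′
      ... | yes refl | _ with () ← trans (sym (reached-free r)) q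
      ... | no _ | yes refl = ends-linked (extend j r (p , sep)) i
      ... | no x≢e | no x≢e′ = edge (trans (exch-other χ j x≢e x≢e′) q , d) (inj₁ refl)

    -- The exchanged edge `e′` lies on the tree path between the ends of `e`, and this path consists
    -- of edges of `D`.
    D-connected : ∀ {χ e} → Reached χ e → Conn D (proj₁ (ends f)) (proj₁ (ends e))
    D-connected start = ε
    D-connected {e = e′} (extend {χ} {e} i r s) with avoid {e = e′} (inj₁ refl) (Conn-sym (ends-linked r i))
    ... | inj₁ c = ⊥-elim (proj₂ s (Conn-sym (Conn-map (λ ((q , _) , ne) → q , ne) c)))
    ... | inj₂ (inj₁ c) = D-connected r ◅◅ Conn-sym (Conn-map (λ ((_ , d) , _) → d) c)
    ... | inj₂ (inj₂ c) = D-connected r ◅◅ Conn-sym (Conn-map (λ ((_ , d) , _) → d) c) ◅◅ edge (_ , extend i r s) (inj₂ refl)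

    -- Each edge on a walk in `D` is left out by some reached colouring of its own, whose colour `i`
    -- links its ends within `D`. Carrying all these links over to `χ` makes the vertex set of `D`
    -- tight.
    D-spanned : ∀ {χ e} → Reached χ e → ∀ i {x} → D x → Conn (Col χ i ∩D) (proj₁ (ends f)) (proj₁ (ends x))
    D-spanned r i (_ , rx) = from-start r i (Conn-bind (λ _ (_ , r′) → to-start r′ i (ends-linked r′ i)) (D-connected rx))

    reached-agrees : ∀ {χ e} → Reached χ e → ∀ x → D x ⊎ χ x ≡ χ₀ x
    reached-agrees start x = inj₂ refl
    reached-agrees (extend {χ} {e} {e′} i r s) x with x ≟ e | x ≟ e′
    ... | yes refl | _        = inj₁ (_ , r)
    ... | no _     | yes refl = inj₁ (_ , extend i r s)
    ... | no _     | no _     = reached-agrees r x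

    -- The coloured edges together with the one left out never change along the chain. Choosing
    -- which edge to leave out therefore chooses where the degree drops.
    reached-deg : ∀ {χ e} → Reached χ e → ∀ v → deg χ v + inc e v ≡ deg χ₀ v + inc f v
    reached-deg start v = refl
    reached-deg (extend {χ} {e} {e′} i r (p , _)) v = begin
      deg (exch χ e e′ i) v + inc e′ v       ≡⟨ cong (deg (exch χ e e′ i) v +_) (+-identityʳ _) ⟨
      deg (exch χ e e′ i) v + (inc e′ v + 0) ≡⟨ exch-weight (λ x c → used c * inc x v) χ i (reached-free r) p ⟩
      deg χ v + (inc e v + 0 + 0)            ≡⟨ cong (deg χ v +_) (trans (+-identityʳ _) (+-identityʳ _)) ⟩
      deg χ v + inc e v                      ≡⟨ reached-deg r v ⟩
      deg χ₀ v + inc f v                     ∎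
      where open ≡-Reasoning

  -- Opaque so that case distinctions on it are not unfolded into one per end.
  opaque
    Inside? : ∀ X → Decidable (Inside G X)
    Inside? X e = (proj₁ (ends e) ∈? X) ×-dec (proj₂ (ends e) ∈? X)

  -- Tight sets

  inside-⊆ : ∀ {X Y e} → X ⊆ Y → Inside G X e → Inside G Y e
  inside-⊆ s (p , q) = s p , s q

  Within : Colouring → Subset n → Fin 2 → Fin m → Set
  Within χ X i e = Col χ i e × Inside G X e

  Tight : Colouring → Subset n → Set
  Tight χ X = ∀ i {u v} → u ∈ X → v ∈ X → Conn (Within χ X i) u v

  tight-centre : ∀ {χ X z} → (∀ i {u} → u ∈ X → Conn (Within χ X i) u z) → Tight χ X
  tight-centre h i u∈ v∈ = h i u∈ ◅◅ Conn-sym (h i v∈)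

  tight-singleton : ∀ {χ} v → Tight χ ⁅ v ⁆
  tight-singleton v i u∈ w∈ with refl ← x∈⁅y⁆⇒x≡y v u∈ | refl ← x∈⁅y⁆⇒x≡y v w∈ = ε

  tight-∪ : ∀ {χ X Y z} → Tight χ X → Tight χ Y → z ∈ X → z ∈ Y → Tight χ (X ∪ Y)
  tight-∪ {χ} {X} {Y} {z} tX tY zX zY = tight-centre λ i {u} u∈ → [ fromX i , fromY i ]′ (x∈p∪q⁻ X Y u∈)
    where
    fromX : ∀ i {u} → u ∈ X → Conn (Within χ (X ∪ Y) i) u z
    fromX i uX = Conn-map (λ (c , ins) → c , inside-⊆ (p⊆p∪q Y) ins) (tX i uX zX)
    fromY : ∀ i {u} → u ∈ Y → Conn (Within χ (X ∪ Y) i) u z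
    fromY i uY = Conn-map (λ (c , ins) → c , inside-⊆ (q⊆p∪q X Y) ins) (tY i uY zY)

  -- An edge of `χ` that may have been recoloured lies inside a set that is tight for `χ′`, so a
  -- walk inside that set replaces it in either colour.
  tight-transfer : ∀ {χ χ′ W} → (∀ e → (∃ λ X → X ⊆ W × Tight χ′ X × Inside G X e) ⊎ χ′ e ≡ χ e) →
                   Tight χ W → Tight χ′ W
  tight-transfer {χ} {χ′} {W} h tW i u∈ v∈ = Conn-bind reroute (tW i u∈ v∈)
    where
    reroute : ∀ e → Within χ W i e → Conn (Within χ′ W i) (proj₁ (ends e)) (proj₂ (ends e))
    reroute e (c , ins) with h e
    ... | inj₁ (X , X⊆W , tX , p , q) = Conn-map (λ (c , ins) → c , inside-⊆ X⊆W ins) (tX i p q)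
    ... | inj₂ eq = edge (trans eq c , ins) (inj₁ refl)

  Agree : Subset n → Colouring → Colouring → Set
  Agree X χ χ′ = ∀ e → Inside G X e ⊎ χ′ e ≡ χ e

  outside-inc : ∀ {X e w} → Inside G X e → w ∉ X → inc e w ≡ 0
  outside-inc {e = e} {w} (p , q) w∉ = cong₂ _+_ (⟦⟧-no (proj₁ (ends e) ≟ w) λ { refl → w∉ p }) (⟦⟧-no (proj₂ (ends e) ≟ w) λ { refl → w∉ q })

  agree-deg : ∀ {X χ χ′ w} → Agree X χ χ′ → w ∉ X → deg χ′ w ≡ deg χ w
  agree-deg {X} {χ} {χ′} {w} ag w∉ = sum-cong-≗ pt
    where
    pt : ∀ e → used (χ′ e) * inc e w ≡ used (χ e) * inc e w
    pt e with ag e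
    ... | inj₂ eq = cong (λ c → used c * inc e w) eq
    ... | inj₁ ins rewrite outside-inc ins w∉ = trans (*-zeroʳ (used (χ′ e))) (sym (*-zeroʳ (used (χ e))))

  graft : Subset n → Colouring → Colouring → Colouring
  graft Y χ χ′ e = if does (Inside? Y e) then χ′ e else χ e

  graft-in : ∀ Y χ χ′ {e} → Inside G Y e → graft Y χ χ′ e ≡ χ′ e
  graft-in Y χ χ′ {e} ins with Inside? Y e
  ... | yes _ = refl
  ... | no ¬i = contradiction ins ¬i

  graft-out : ∀ Y χ χ′ {e} → ¬ Inside G Y e → graft Y χ χ′ e ≡ χ e
  graft-out Y χ χ′ {e} ¬i with Inside? Y e
  ... | yes ins = contradiction ins ¬i
  ... | no _ = refl

  -- On every edge at least one of the two recolourings coincides with `χ`: `χ₁` inside `Y`, `χ₂`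
  -- elsewhere.
  graft-weight : ∀ g Y {χ χ₁ χ₂} → Agree Y χ χ₂ → (∀ e → Inside G Y e → χ₁ e ≡ χ e) →
                 weight g (graft Y χ₁ χ₂) + weight g χ ≡ weight g χ₁ + weight g χ₂
  graft-weight g Y {χ} {χ₁} {χ₂} ag same = trans (sym (∑-distrib-+ (λ e → g e (graft Y χ₁ χ₂ e)) _)) (trans (sum-cong-≗ pt) (∑-distrib-+ (λ e → g e (χ₁ e)) _))
    where
    pt : ∀ e → g e (graft Y χ₁ χ₂ e) + g e (χ e) ≡ g e (χ₁ e) + g e (χ₂ e)
    pt e with Inside? Y e
    ... | yes ins = trans (+-comm (g e (χ₂ e)) _) (cong (λ c → g e c + g e (χ₂ e)) (sym (same e ins)))
    ... | no ¬ins = cong (λ c → g e (χ₁ e) + g e c) (sym ([ (λ ins → contradiction ins ¬ins) , id ]′ (ag e)))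

  -- Edges of `χ₁` outside `Y` survive. Those inside `Y` are replaced by walks of `χ₂`, because `Y`
  -- is tight for it.
  graft-trees : ∀ Y {χ χ₁ χ₂} → Agree Y χ χ₂ → (∀ e → Inside G Y e → χ₁ e ≡ χ e) → Tight χ₂ Y →
                Trees χ → Trees χ₁ → Trees χ₂ → Trees (graft Y χ₁ χ₂)
  graft-trees Y {χ} {χ₁} {χ₂} ag same tY T T₁ T₂ i = (λ u v → Conn-bind reroute (proj₁ (T₁ i) u v)) ,
    +-cancelʳ-≡ (size (Col? χ i)) _ _ (begin
      size (Col? χ′ i) + 1 + size (Col? χ i)  ≡⟨ shuffle (size (Col? χ′ i)) _ ⟩
      size (Col? χ′ i) + size (Col? χ i) + 1  ≡⟨ cong (_+ 1) (graft-weight (λ _ c → ⟦ c ≟ᶜ just i ⟧) Y ag same) ⟩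
      size (Col? χ₁ i) + size (Col? χ₂ i) + 1 ≡⟨ shuffle (size (Col? χ₁ i)) _ ⟨
      size (Col? χ₁ i) + 1 + size (Col? χ₂ i) ≡⟨ cong₂ _+_ (proj₂ (T₁ i)) (+-cancelʳ-≡ 1 _ _ (trans (proj₂ (T₂ i)) (sym (proj₂ (T i))))) ⟩
      n + size (Col? χ i) ∎)
    where
    open ≡-Reasoning
    χ′ = graft Y χ₁ χ₂
    shuffle : ∀ a b → a + 1 + b ≡ a + b + 1
    shuffle = solve-∀
    reroute : ∀ e → Col χ₁ i e → Conn (Col χ′ i) (proj₁ (ends e)) (proj₂ (ends e))
    reroute e c with Inside? Y e
    ... | no ¬ins = edge (trans (graft-out Y χ₁ χ₂ ¬ins) c) (inj₁ refl)
    ... | yes (p , q) = Conn-map (λ (c , ins) → trans (graft-in Y χ₁ χ₂ ins) c) (tY i p q)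

  -- Reducible vertices and the shrinking of `B`

  Avoids : Subset n → Subset n → Set
  Avoids B X = ∀ {w} → w ∈ X → w ∉ B

  Together : Colouring → Subset n → Fin n → Fin n → Set
  Together χ B u v = ∃ λ X → Avoids B X × Tight χ X × u ∈ X × v ∈ X

  -- The degree of v can be pushed below M by recolouring inside a tight set
  -- that avoids B.
  record Reducible (χ : Colouring) (M : Fin n → ℕ) (B : Subset n) (v : Fin n) : Set where
    field
      X      : Subset n
      χ′     : Colouring
      avoids : Avoids B X
      v∈X    : v ∈ X
      -- Both kinds of tightness matter: for `χ` it keeps `X` within one class, for `χ′` it allows
      -- the recolouring to be combined with others.
      tight  : Tight χ X
      tight′ : Tight χ′ X
      trees′ : Trees χ′
      agree  : Agree X χ χ′
      deg≤   : ∀ w → deg χ′ w ≤ M w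
      deg<   : deg χ′ v < M v

  reducible-⊆ : ∀ {χ M B B′ v} → B′ ⊆ B → Reducible χ M B v → Reducible χ M B′ v
  reducible-⊆ B′⊆B R = record
    { X = X ; χ′ = χ′ ; avoids = λ w∈ → avoids w∈ ∘ B′⊆B ; v∈X = v∈X ; tight = tight ; tight′ = tight′
    ; trees′ = trees′ ; agree = agree ; deg≤ = deg≤ ; deg< = deg< }
    where open Reducible R

  module Step {χ : Colouring} (T : Trees χ) {M : Fin n → ℕ} {B : Subset n} {e : Fin m}
    (Rx : Reducible χ M B (proj₁ (ends e))) (Ry : Reducible χ M B (proj₂ (ends e)))
    (free : χ e ≡ nothing) (apart : ¬ Together χ B (proj₁ (ends e)) (proj₂ (ends e))) where

    x = proj₁ (ends e)
    y = proj₂ (ends e)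
    open Reducible Rx renaming (χ′ to χx; avoids to X-avoids; v∈X to x∈X; tight to X-tight; tight′ to X-tight′; trees′ to X-trees; agree to X-agree; deg≤ to X-deg≤; deg< to X-deg<)
    open Reducible Ry renaming (X to Y; χ′ to χy; avoids to Y-avoids; v∈X to y∈Y; tight to Y-tight; tight′ to Y-tight′; trees′ to Y-trees; agree to Y-agree; deg≤ to Y-deg≤; deg< to Y-deg<)

    ∪-avoids : ∀ {X Y} → Avoids B X → Avoids B Y → Avoids B (X ∪ Y)
    ∪-avoids {X} {Y} a b w∈ = [ a , b ]′ (x∈p∪q⁻ X Y w∈)

    -- This is where `apart` is needed first: it makes the two recolourings independent, so that
    -- `χ₁` can perform both.
    disjoint : ∀ {z} → z ∈ X → z ∉ Y
    disjoint zX zY = apart (X ∪ Y , ∪-avoids X-avoids Y-avoids , tight-∪ X-tight Y-tight zX zY , p⊆p∪q Y x∈X , q⊆p∪q X Y y∈Y)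

    same : ∀ e → Inside G Y e → χx e ≡ χ e
    same e (p , _) = [ (λ (q , _) → contradiction p (disjoint q)) , id ]′ (X-agree e)

    χ₁ : Colouring
    χ₁ = graft Y χx χy

    T₁ : Trees χ₁
    T₁ = graft-trees Y Y-agree same Y-tight′ T X-trees Y-trees

    χ₁-inX : ∀ {e} → Inside G X e → χ₁ e ≡ χx e
    χ₁-inX (p , _) = graft-out Y χx χy λ (q , _) → disjoint p q

    χ₁-tight-X : Tight χ₁ X
    χ₁-tight-X i u∈ v∈ = Conn-map (λ (c , ins) → trans (χ₁-inX ins) c , ins) (X-tight′ i u∈ v∈)

    χ₁-tight-Y : Tight χ₁ Y
    χ₁-tight-Y i u∈ v∈ = Conn-map (λ (c , ins) → trans (graft-in Y χx χy ins) c , ins) (Y-tight′ i u∈ v∈)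

    χ₁-agree : ∀ e → Inside G X e ⊎ Inside G Y e ⊎ χ₁ e ≡ χ e
    χ₁-agree e with Inside? Y e | X-agree e
    ... | yes ins | _        = inj₂ (inj₁ ins)
    ... | no _    | inj₁ ins = inj₁ ins
    ... | no _    | inj₂ eq  = inj₂ (inj₂ eq)

    χ₁-free : χ₁ e ≡ nothing
    χ₁-free with χ₁-agree e
    ... | inj₁ (_ , q)        = contradiction y∈Y (disjoint q)
    ... | inj₂ (inj₁ (p , _)) = contradiction p (disjoint x∈X)
    ... | inj₂ (inj₂ eq)      = trans eq free

    χ₁-deg-sum : ∀ w → deg χ₁ w + deg χ w ≡ deg χx w + deg χy w
    χ₁-deg-sum w = graft-weight (λ e c → used c * inc e w) Y Y-agree same

    χ₁-deg-outY : ∀ {w} → w ∉ Y → deg χ₁ w ≡ deg χx w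
    χ₁-deg-outY {w} w∉ = +-cancelʳ-≡ (deg χ w) _ _ (trans (χ₁-deg-sum w) (cong (deg χx w +_) (agree-deg Y-agree w∉)))

    χ₁-deg-outX : ∀ {w} → w ∉ X → deg χ₁ w ≡ deg χy w
    χ₁-deg-outX {w} w∉ = +-cancelʳ-≡ (deg χ w) _ _ (trans (χ₁-deg-sum w) (trans (cong (_+ deg χy w) (agree-deg X-agree w∉)) (+-comm (deg χ w) _)))

    -- Each end of `e` has a spare unit, from its own recolouring, while the other recolouring
    -- leaves its degree alone. So `e` can be added without exceeding `M`.
    χ₁-deg≤ : ∀ w → deg χ₁ w + inc e w ≤ M w
    χ₁-deg≤ w with x ≟ w | y ≟ w
    ... | yes refl | yes eq  = contradiction (sym eq) (loopless e)
    ... | yes refl | no _    = subst (_≤ M x) (trans (cong suc (sym (χ₁-deg-outY (disjoint x∈X)))) (+-comm 1 _)) X-deg<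
    ... | no _     | yes refl = subst (_≤ M y) (trans (cong suc (sym (χ₁-deg-outX λ y∈X → disjoint y∈X y∈Y))) (+-comm 1 _)) Y-deg<
    ... | no _     | no _ with w ∈? Y
    ...   | no w∉ = ≤-trans (≤-reflexive (trans (+-identityʳ _) (χ₁-deg-outY w∉))) (X-deg≤ w)
    ...   | yes w∈ = ≤-trans (≤-reflexive (trans (+-identityʳ _) (χ₁-deg-outX λ w∈X → disjoint w∈X w∈))) (Y-deg≤ w)

    open Exchanges T₁ χ₁-free

    -- A decision for this is taken as a parameter below; the caller, whose goal is `⊥`, provides it
    -- by excluded middle.
    Touched : Fin n → Set
    Touched v = ∃ λ x → D x × (v ≡ proj₁ (ends x) ⊎ v ≡ proj₂ (ends x))

    module _ (touched? : Decidable Touched) where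
      U = subset touched?
      -- `U` carries only the exchanges. The colourings reached also differ from `χ` by the two
      -- recolourings inside `X` and `Y`.
      W = (X ∪ U) ∪ Y

      D-inside : ∀ {x} → D x → Inside G U x
      D-inside d = ∈-subset⁺ touched? (_ , d , inj₁ refl) , ∈-subset⁺ touched? (_ , d , inj₂ refl)

      e-inside : Inside G U e
      e-inside = D-inside (_ , start)

      U-tight : ∀ {χ₂ e₂} → Reached χ₂ e₂ → Tight χ₂ U
      U-tight {χ₂} r = tight-centre λ i u∈ → Conn-sym (h i (∈-subset⁻ touched? u∈))
        where
        grow : ∀ {i u v} → Conn (Col χ₂ i ∩D) u v → Conn (Within χ₂ U i) u v
        grow = Conn-map λ (c , d) → c , D-inside d
        h : ∀ i {u} → Touched u → Conn (Within χ₂ U i) x u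
        h i (_ , d , inj₁ refl) = grow (D-spanned r i d)
        h i (_ , d , inj₂ refl) = grow (D-spanned r i d ◅◅ from-start r i (to-start (proj₂ d) i (ends-linked (proj₂ d) i)))

      X⊆W : X ⊆ W
      X⊆W = p⊆p∪q Y ∘ p⊆p∪q U
      U⊆W : U ⊆ W
      U⊆W = p⊆p∪q Y ∘ q⊆p∪q X U
      Y⊆W : Y ⊆ W
      Y⊆W = q⊆p∪q (X ∪ U) Y

      W-tight₁ : Tight χ₁ W
      W-tight₁ = tight-∪ (tight-∪ χ₁-tight-X (U-tight start) x∈X (proj₁ e-inside)) χ₁-tight-Y (q⊆p∪q X U (proj₂ e-inside)) y∈Y

      W-tight : Tight χ W
      W-tight = tight-transfer h W-tight₁
        where
        h : ∀ e → (∃ λ Z → Z ⊆ W × Tight χ Z × Inside G Z e) ⊎ χ e ≡ χ₁ e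
        h e with χ₁-agree e
        ... | inj₁ ins        = inj₁ (X , X⊆W , X-tight , ins)
        ... | inj₂ (inj₁ ins) = inj₁ (Y , Y⊆W , Y-tight , ins)
        ... | inj₂ (inj₂ eq)  = inj₂ (sym eq)

      W-tight₂ : ∀ {χ₂ e₂} → Reached χ₂ e₂ → Tight χ₂ W
      W-tight₂ {χ₂} r = tight-transfer h W-tight₁
        where
        h : ∀ e → (∃ λ Z → Z ⊆ W × Tight χ₂ Z × Inside G Z e) ⊎ χ₂ e ≡ χ₁ e
        h e with reached-agrees r e
        ... | inj₁ d  = inj₁ (U , U⊆W , U-tight r , D-inside d)
        ... | inj₂ eq = inj₂ eq

      W-agree : ∀ {χ₂ e₂} → Reached χ₂ e₂ → Agree W χ χ₂
      W-agree r e with reached-agrees r e | χ₁-agree e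
      ... | inj₁ d  | _               = inj₁ (inside-⊆ U⊆W (D-inside d))
      ... | inj₂ _  | inj₁ ins        = inj₁ (inside-⊆ X⊆W ins)
      ... | inj₂ _  | inj₂ (inj₁ ins) = inj₁ (inside-⊆ Y⊆W ins)
      ... | inj₂ eq | inj₂ (inj₂ eq′) = inj₂ (trans eq eq′)

      W-avoids : ∀ {C} → Avoids C U → Avoids C X → Avoids C Y → Avoids C W
      W-avoids aU aX aY w∈ = [ (λ w∈ → [ aX , aU ]′ (x∈p∪q⁻ X U w∈)) , aY ]′ (x∈p∪q⁻ (X ∪ U) Y w∈)

      meets : Nonempty (B ∩ U)
      meets with nonempty? (B ∩ U)
      ... | yes ne = ne
      ... | no ¬ne = ⊥-elim (apart (W , W-avoids (λ {w} w∈U w∈B → ¬ne (w , x∈p∩q⁺ (w∈B , w∈U))) X-avoids Y-avoids , W-tight , X⊆W x∈X , Y⊆W y∈Y))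

      B─U⊆B : B ─ U ⊆ B
      B─U⊆B = p─q⊆p B U

      -- As `v` is swept out, it is an end of some `e₂` in `D`. The colouring that leaves out `e₂`
      -- stays within `M` even with `e₂` added back, so it is strictly below `M` at the ends of
      -- `e₂`.
      reduced : ∀ {v} → v ∈ U → Reducible χ M (B ─ U) v
      reduced {v} v∈U with ∈-subset⁻ touched? v∈U
      ... | e₂ , (χ₂ , r) , v∈e₂ = record
        { X = W ; χ′ = χ₂
        ; avoids = W-avoids (λ w∈U w∈ → x∈p∩q≢ w∈ w∈U) (λ w∈ → X-avoids w∈ ∘ B─U⊆B) (λ w∈ → Y-avoids w∈ ∘ B─U⊆B)
        ; v∈X = U⊆W v∈U ; tight = W-tight ; tight′ = W-tight₂ r ; trees′ = reached-trees r ; agree = W-agree r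
        ; deg≤ = λ w → m+n≤o⇒m≤o _ (bound w)
        ; deg< = ≤-trans (≤-reflexive (+-comm 1 _)) (≤-trans (+-monoʳ-≤ (deg χ₂ v) inc≥1) (bound v)) }
        where
        x∈p∩q≢ : ∀ {w} → w ∈ B ─ U → w ∉ U
        x∈p∩q≢ = ∈─⁻ B U
          where
          ∈─⁻ : ∀ {k} (p q : Subset k) {w} → w ∈ p ─ q → w ∉ q
          ∈─⁻ (_ ∷ p) (_ ∷ q) (there w∈) (there w∈q) = ∈─⁻ p q w∈ w∈q
          ∈─⁻ (_ ∷ p) (.inside ∷ q) () here
        bound : ∀ w → deg χ₂ w + inc e₂ w ≤ M w
        bound w = subst (_≤ M w) (sym (reached-deg r w)) (χ₁-deg≤ w)
        inc≥1 : 1 ≤ inc e₂ v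
        inc≥1 = [ (λ { refl → ≤-trans (≤-reflexive (sym (⟦⟧-yes (v ≟ v) refl))) (m≤m+n _ _) }) ,
                  (λ { refl → ≤-trans (≤-reflexive (sym (⟦⟧-yes (v ≟ v) refl))) (m≤n+m _ _) }) ]′ v∈e₂

      shrink : (∀ {v} → v ∉ B → Reducible χ M B v) →
               ∃ λ B′ → B′ ⊂ B × (∀ {v} → v ∉ B′ → Reducible χ M B′ v)
      shrink all = B ─ U , p∩q≢∅⇒p─q⊂p B U meets , h
        where
        h : ∀ {v} → v ∉ B ─ U → Reducible χ M (B ─ U) v
        h {v} v∉ with v ∈? B | v ∈? U
        ... | _      | yes v∈U = reduced v∈U
        ... | yes v∈ | no v∉U  = contradiction (x∈p∧x∉q⇒x∈p─q v∈ v∉U) v∉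
        ... | no v∉B | no _    = reducible-⊆ B─U⊆B (all v∉B)

  -- Decidable connection and edge counts inside vertex sets

  Closed : (Fin m → Set) → Subset n → Set
  Closed P X = ∀ {e u v} → P e → Joins G e u v → u ∈ X → v ∈ X

  reachable : ∀ {P} → Decidable P → ∀ u → ∃ λ X → u ∈ X × (∀ {v} → v ∈ X → Conn P u v) × Closed P X
  reachable {P} P? u = grow n ⁅ u ⁆ (m≤m+n n _) (x∈⁅x⁆ u) λ v∈ → subst (Conn P u) (sym (x∈⁅y⁆⇒x≡y u v∈)) ε
    where
    Exit : Subset n → Fin m → Set
    Exit X e = P e × ((proj₁ (ends e) ∈ X × proj₂ (ends e) ∉ X) ⊎ (proj₂ (ends e) ∈ X × proj₁ (ends e) ∉ X))
    exit? : ∀ X → Decidable (Exit X)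
    exit? X e = P? e ×-dec ((a ×-dec ¬? b) ⊎-dec (b ×-dec ¬? a))
      where
      a = proj₁ (ends e) ∈? X
      b = proj₂ (ends e) ∈? X
    grow : ∀ k X → n ≤ k + ∣ X ∣ → u ∈ X → (∀ {v} → v ∈ X → Conn P u v) →
           ∃ λ X → u ∈ X × (∀ {v} → v ∈ X → Conn P u v) × Closed P X
    grow k X le u∈ con with any? (exit? X)
    ... | no ¬exit = X , u∈ , con , closed
      where
      closed : Closed P X
      closed {e} p (inj₁ refl) a∈ with proj₂ (ends e) ∈? X
      ... | yes b∈ = b∈
      ... | no b∉  = contradiction (e , p , inj₁ (a∈ , b∉)) ¬exit
      closed {e} p (inj₂ refl) b∈ with proj₁ (ends e) ∈? X
      ... | yes a∈ = a∈
      ... | no a∉  = contradiction (e , p , inj₂ (b∈ , a∉)) ¬exit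
    ... | yes (e , p , q) = [ (λ (a∈ , b∉) → add k le a∈ b∉ (inj₁ refl)) , (λ (b∈ , a∉) → add k le b∈ a∉ (inj₂ refl)) ]′ q
      where
      add : ∀ k → n ≤ k + ∣ X ∣ → ∀ {x y} → x ∈ X → y ∉ X → Joins G e x y →
            ∃ λ X → u ∈ X × (∀ {v} → v ∈ X → Conn P u v) × Closed P X
      add k le {x} {y} x∈ y∉ j = next-step k le
        where
        X′ = X ∪ ⁅ y ⁆
        bigger : ∣ X ∣ < ∣ X′ ∣
        bigger = p⊂q⇒∣p∣<∣q∣ (p⊆p∪q ⁅ y ⁆ , y , q⊆p∪q X ⁅ y ⁆ (x∈⁅x⁆ y) , y∉)
        con′ : ∀ {v} → v ∈ X′ → Conn P u v
        con′ v∈ = [ con , (λ v∈y → subst (Conn P u) (sym (x∈⁅y⁆⇒x≡y y v∈y)) (con x∈ ◅◅ edge p j)) ]′ (x∈p∪q⁻ X ⁅ y ⁆ v∈)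
        next-step : ∀ k → n ≤ k + ∣ X ∣ → ∃ λ X → u ∈ X × (∀ {v} → v ∈ X → Conn P u v) × Closed P X
        next-step zero le = contradiction (<-≤-trans bigger (≤-trans (∣p∣≤n X′) le)) (<-irrefl refl)
        next-step (suc k) le = grow k X′ (≤-trans le (≤-trans (≤-reflexive (sym (+-suc k ∣ X ∣))) (+-monoʳ-≤ k bigger))) (p⊆p∪q ⁅ y ⁆ u∈) con′

  Conn? : ∀ {P} → Decidable P → ∀ u v → Dec (Conn P u v)
  Conn? {P} P? u v with reachable P? u
  ... | X , u∈ , con , closed with v ∈? X
  ...   | yes v∈ = yes (con v∈)
  ...   | no v∉  = no λ c → v∉ (stays c u∈)
    where
    stays : ∀ {x y} → Conn P x y → x ∈ X → y ∈ X
    stays ε x∈ = x∈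
    stays ((_ , p , j) ◅ c) x∈ = stays c (closed p j x∈)

  -- In `dominating`, every vertex outside `X` represents itself, and `z` represents all of `X`.
  spanning-lower : ∀ {P} (P? : Decidable P) {X z} → (∀ {u} → u ∈ X → Conn P u z) → ∣ X ∣ ≤ size P? + 1
  spanning-lower {P} P? {X} {z} h = +-cancelʳ-≤ (sum c) ∣ X ∣ (size P? + 1) (begin
    ∣ X ∣ + sum c                           ≡⟨ card-∁ X ⟩
    n                                       ≤⟨ dominating P? (λ v → ⟦ v ≟ z ⟧ + c v) dom ⟩
    size P? + sum (λ v → ⟦ v ≟ z ⟧ + c v)   ≡⟨ cong (size P? +_) (trans (∑-distrib-+ (λ v → ⟦ v ≟ z ⟧) c) (cong (_+ sum c) (sum-δ z))) ⟩
    size P? + (1 + sum c)                   ≡⟨ +-assoc (size P?) 1 _ ⟨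
    size P? + 1 + sum c                     ∎)
    where
    open ≤-Reasoning
    c : Fin n → ℕ
    c v = ⟦ v ∈? ∁ X ⟧
    dom : ∀ v → ∃ λ w → 1 ≤ ⟦ w ≟ z ⟧ + c w × Conn P v w
    dom v with v ∈? X
    ... | yes v∈ = z , ≤-trans (≤-reflexive (sym (⟦⟧-yes (z ≟ z) refl))) (m≤m+n _ _) , h v∈
    ... | no v∉  = v , ≤-trans (≤-reflexive (sym (⟦⟧-yes (v ∈? ∁ X) (x∉p⇒x∈∁p v∉)))) (m≤n+m _ _) , ε

  Within? : ∀ χ X i → Decidable (Within χ X i)
  Within? χ X i e = Col? χ i e ×-dec Inside? X e

  Beyond? : ∀ χ X i → Decidable (λ e → Col χ i e × ¬ Inside G X e)
  Beyond? χ X i e = Col? χ i e ×-dec ¬? (Inside? X e)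

  -- The walk is cut at its first vertex in `X`. Every edge before that starts outside `X`.
  enter : ∀ {P X v z} → Conn P v z → z ∈ X → ∃ λ w → w ∈ X × Conn (λ e → P e × ¬ Inside G X e) v w
  enter ε z∈ = _ , z∈ , ε
  enter {X = X} {v} ((e , p , j) ◅ c) z∈ with v ∈? X
  ... | yes v∈ = v , v∈ , ε
  ... | no v∉ with enter c z∈
  ...   | w , w∈ , c′ = w , w∈ , (e , (p , λ ins → v∉ (start∈ j ins)) , j) ◅ c′
    where
    start∈ : ∀ {u w} → Joins G e u w → Inside G X e → u ∈ X
    start∈ (inj₁ refl) (a , _) = a
    start∈ (inj₂ refl) (_ , b) = b

  -- The edges of colour `i` that are not inside `X` bring every vertex to `X`, so there are at
  -- least n - |X| of them among n - 1.
  forest-bound : ∀ {χ X z} → Trees χ → z ∈ X → ∀ i → size (Within? χ X i) + 1 ≤ ∣ X ∣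
  forest-bound {χ} {X} {z} T z∈ i = +-cancelˡ-≤ (size (Beyond? χ X i)) (size (Within? χ X i) + 1) ∣ X ∣ (begin
    size (Beyond? χ X i) + (size (Within? χ X i) + 1) ≡⟨ +-assoc (size (Beyond? χ X i)) _ 1 ⟨
    size (Beyond? χ X i) + size (Within? χ X i) + 1   ≡⟨ cong (_+ 1) (∑-distrib-+ (λ e → ⟦ Beyond? χ X i e ⟧) _) ⟨
    sum (λ e → ⟦ Beyond? χ X i e ⟧ + ⟦ Within? χ X i e ⟧) + 1 ≡⟨ cong (_+ 1) (sum-cong-≗ pt) ⟩
    size (Col? χ i) + 1                               ≡⟨ proj₂ (T i) ⟩
    n                                                 ≤⟨ dominating (Beyond? χ X i) (λ v → ⟦ v ∈? X ⟧) dom ⟩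
    size (Beyond? χ X i) + sum (λ v → ⟦ v ∈? X ⟧)     ≡⟨ cong (size (Beyond? χ X i) +_) (card X) ⟨
    size (Beyond? χ X i) + ∣ X ∣                      ∎)
    where
    open ≤-Reasoning
    pt : ∀ e → ⟦ Beyond? χ X i e ⟧ + ⟦ Within? χ X i e ⟧ ≡ ⟦ Col? χ i e ⟧
    pt e with Col? χ i e | Inside? X e
    ... | yes _ | yes _ = refl
    ... | yes _ | no _  = refl
    ... | no _  | _     = refl
    dom : ∀ v → ∃ λ w → 1 ≤ ⟦ w ∈? X ⟧ × Conn (λ e → Col χ i e × ¬ Inside G X e) v w
    dom v with enter (proj₁ (T i) v z) z∈
    ... | w , w∈ , c = w , ≤-reflexive (sym (⟦⟧-yes (w ∈? X) w∈)) , c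

  -- Otherwise X splits into two nonempty parts with no edge of colour i between
  -- them, and the forest bound on both parts leaves X one edge short.
  full⇒connected : ∀ {χ X} → Trees χ → ∀ i → ∣ X ∣ ≤ size (Within? χ X i) + 1 →
                   ∀ {u v} → u ∈ X → v ∈ X → Conn (Within χ X i) u v
  full⇒connected {χ} {X} T i full {u} {v} u∈ v∈ with Conn? (Within? χ X i) u v
  ... | yes c = c
  ... | no ¬c = contradiction (begin-strict
    ∣ X ∣                                     ≤⟨ full ⟩
    w X + 1                                   ≤⟨ +-monoˡ-≤ 1 (≤-trans (sum-mono edges) (≤-reflexive (∑-distrib-+ (λ e → ⟦ Within? χ X₁ i e ⟧) _))) ⟩
    w X₁ + w X₂ + 1                           <⟨ ≤-reflexive (shuffle (w X₁) (w X₂)) ⟩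
    (w X₁ + 1) + (w X₂ + 1)                   ≤⟨ +-mono-≤ (forest-bound T (∈-subset⁺ near? (u∈ , ε)) i) (forest-bound T (∈-subset⁺ far? (v∈ , ¬c)) i) ⟩
    ∣ X₁ ∣ + ∣ X₂ ∣                           ≡⟨ cong₂ _+_ (card-tabulate (does ∘ near?)) (card-tabulate (does ∘ far?)) ⟩
    sum (λ x → ⟦ near? x ⟧) + sum (λ x → ⟦ far? x ⟧) ≡⟨ ∑-distrib-+ (λ x → ⟦ near? x ⟧) _ ⟨
    sum (λ x → ⟦ near? x ⟧ + ⟦ far? x ⟧)      ≡⟨ sum-cong-≗ parts ⟩
    sum (λ x → ⟦ x ∈? X ⟧)                    ≡⟨ card X ⟨
    ∣ X ∣                                     ∎) (<-irrefl refl)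
    where
    open ≤-Reasoning
    w : Subset n → ℕ
    w X = size (Within? χ X i)
    shuffle : ∀ a b → suc (a + b + 1) ≡ (a + 1) + (b + 1)
    shuffle = solve-∀
    conn? : ∀ x → Dec (Conn (Within χ X i) u x)
    conn? = Conn? (Within? χ X i) u
    near? : Decidable (λ x → x ∈ X × Conn (Within χ X i) u x)
    near? x = (x ∈? X) ×-dec conn? x
    far? : Decidable (λ x → x ∈ X × ¬ Conn (Within χ X i) u x)
    far? x = (x ∈? X) ×-dec ¬? (conn? x)
    X₁ = subset near?
    X₂ = subset far?
    parts : ∀ x → ⟦ near? x ⟧ + ⟦ far? x ⟧ ≡ ⟦ x ∈? X ⟧
    parts x with x ∈? X | conn? x
    ... | yes _ | yes _ = refl
    ... | yes _ | no _  = refl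
    ... | no _  | _     = refl
    edges : ∀ e → ⟦ Within? χ X i e ⟧ ≤ ⟦ Within? χ X₁ i e ⟧ + ⟦ Within? χ X₂ i e ⟧
    edges e with Col? χ i e
    ... | no _ = z≤n
    ... | yes c with Inside? X e
    ...   | no _ = z≤n
    ...   | yes (a∈ , b∈) with conn? (proj₁ (ends e))
    ...     | yes ua = ≤-trans (≤-reflexive (sym (⟦⟧-yes (Inside? X₁ e)
                (∈-subset⁺ near? (a∈ , ua) , ∈-subset⁺ near? (b∈ , ua ◅◅ edge (c , a∈ , b∈) (inj₁ refl)))))) (m≤m+n _ _)
    ...     | no ¬ua = ≤-trans (≤-reflexive (sym (⟦⟧-yes (Inside? X₂ e)
                (∈-subset⁺ far? (a∈ , ¬ua) , ∈-subset⁺ far? (b∈ , λ ub → ¬ua (ub ◅◅ edge (c , a∈ , b∈) (inj₂ refl))))))) (m≤n+m _ _)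

  Reach⇒Conn : ∀ {F u v} → Reach G F u v → Conn (_∈ F) u v
  Reach⇒Conn here = ε
  Reach⇒Conn (step e e∈ j r) = (e , e∈ , j) ◅ Reach⇒Conn r

  Conn⇒Reach : ∀ {F u v} → Conn (_∈ F) u v → Reach G F u v
  Conn⇒Reach ε = here
  Conn⇒Reach ((e , e∈ , j) ◅ c) = step e e∈ j (Conn⇒Reach c)

  tight⇒treeConnected : ∀ {χ X z} → Trees χ → Tight χ X → z ∈ X → TreeConnected G 2 X
  tight⇒treeConnected {χ} {X} T tX z∈ = F , tree , disjoint
    where
    F : Fin 2 → Subset m
    F i = subset (Within? χ X i)
    tree : ∀ i → SpanningTree G X (F i)
    tree i = (λ e e∈ → proj₂ (∈-subset⁻ (Within? χ X i) e∈)) ,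
      (λ u v u∈ v∈ → Conn⇒Reach (Conn-map (∈-subset⁺ (Within? χ X i)) (tX i u∈ v∈))) ,
      trans (cong (_+ 1) (card-tabulate (does ∘ Within? χ X i)))
        (≤-antisym (forest-bound T z∈ i) (spanning-lower (Within? χ X i) λ u∈ → tX i u∈ z∈))
    disjoint : ∀ i j → i ≢ j → ∀ e → e ∈ F i → e ∉ F j
    disjoint i j i≢j e ei ej = i≢j (just-injective (trans (sym (proj₁ (∈-subset⁻ (Within? χ X i) ei))) (proj₁ (∈-subset⁻ (Within? χ X j) ej))))

  colour : ∀ χ e → χ e ≡ nothing ⊎ ∃ λ i → Col χ i e
  colour χ e with χ e
  ... | nothing = inj₁ refl
  ... | just i  = inj₂ (i , refl)

  -- The partition into tight classes

  Together-refl : ∀ {χ B u} → u ∉ B → Together χ B u u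
  Together-refl {u = u} u∉ = ⁅ u ⁆ , (λ w∈ → subst (_∉ _) (sym (x∈⁅y⁆⇒x≡y u w∈)) u∉) , tight-singleton u , x∈⁅x⁆ u , x∈⁅x⁆ u

  Together-sym : ∀ {χ B u v} → Together χ B u v → Together χ B v u
  Together-sym (X , av , t , u∈ , v∈) = X , av , t , v∈ , u∈

  Together-trans : ∀ {χ B u v w} → Together χ B u v → Together χ B v w → Together χ B u w
  Together-trans (X , avX , tX , u∈ , vX) (Y , avY , tY , vY , w∈) =
    X ∪ Y , (λ z∈ → [ avX , avY ]′ (x∈p∪q⁻ X Y z∈)) , tight-∪ tX tY vX vY , p⊆p∪q Y u∈ , q⊆p∪q X Y w∈

  -- Greedy choice: a vertex becomes a representative when it is related to none of those chosen so
  -- far.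
  transversal : ∀ {X : Subset n} {R : Fin n → Fin n → Set} → (∀ u v → Dec (R u v)) →
                (∀ {u} → u ∈ X → R u u) → (∀ {u v} → R u v → R v u) →
                ∃ λ p → ∃ λ (rep : Fin p → Fin n) →
                  (∀ i → rep i ∈ X) × (∀ i j → R (rep i) (rep j) → i ≡ j) × (∀ {v} → v ∈ X → ∃ λ i → R v (rep i))
  transversal {X} {R} R? R-refl R-sym with go n id
    where
    go : ∀ k (ι : Fin k → Fin n) → ∃ λ p → ∃ λ (rep : Fin p → Fin n) →
         (∀ i → rep i ∈ X) × (∀ i j → R (rep i) (rep j) → i ≡ j) × (∀ x → ι x ∈ X → ∃ λ i → R (ι x) (rep i))
    go zero ι = 0 , (λ ()) , (λ ()) , (λ ()) , λ ()
    go (suc k) ι with go k (ι ∘ suc)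
    ... | p , rep , rep∈ , inj , cover with ι zero ∈? X | any? (λ i → R? (ι zero) (rep i))
    ...   | no ∉X | _ = p , rep , rep∈ , inj , λ { zero ∈X → contradiction ∈X ∉X ; (suc x) → cover x }
    ...   | yes _ | yes c = p , rep , rep∈ , inj , λ { zero _ → c ; (suc x) → cover x }
    ...   | yes ∈X | no ¬c = suc p , rep′ , rep∈′ , inj′ , cover′
      where
      rep′ : Fin (suc p) → Fin n
      rep′ zero    = ι zero
      rep′ (suc i) = rep i
      rep∈′ : ∀ i → rep′ i ∈ X
      rep∈′ zero    = ∈X
      rep∈′ (suc i) = rep∈ i
      inj′ : ∀ i j → R (rep′ i) (rep′ j) → i ≡ j
      inj′ zero    zero    _ = refl
      inj′ zero    (suc j) r = contradiction (j , r) ¬c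
      inj′ (suc i) zero    r = contradiction (i , R-sym r) ¬c
      inj′ (suc i) (suc j) r = cong suc (inj i j r)
      cover′ : ∀ x → ι x ∈ X → ∃ λ i → R (ι x) (rep′ i)
      cover′ zero    x∈ = zero , R-refl x∈
      cover′ (suc x) x∈ = suc (proj₁ (cover x x∈)) , proj₂ (cover x x∈)
  ... | p , rep , rep∈ , inj , cover = p , rep , rep∈ , inj , λ {v} → cover v

  sum-pick : ∀ {k} p (f : Fin k → ℕ) → sum (λ v → ⟦ p ≟ v ⟧ * f v) ≡ f p
  sum-pick p f = trans (sum-cong-≗ pt) (sum-δ* p (f p))
    where
    pt : ∀ v → ⟦ p ≟ v ⟧ * f v ≡ ⟦ v ≟ p ⟧ * f p
    pt v with p ≟ v
    ... | yes refl = cong (_* f p) (sym (⟦⟧-yes (p ≟ p) refl))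
    ... | no p≢v   = cong (_* f p) (sym (⟦⟧-no (v ≟ p) (p≢v ∘ sym)))

  inc-sum : ∀ (f : Fin n → ℕ) e → sum (λ v → f v * inc e v) ≡ f (proj₁ (ends e)) + f (proj₂ (ends e))
  inc-sum f e = trans (sum-cong-≗ pt) (trans (∑-distrib-+ (λ v → ⟦ a ≟ v ⟧ * f v) _) (cong₂ _+_ (sum-pick a f) (sum-pick b f)))
    where
    a = proj₁ (ends e)
    b = proj₂ (ends e)
    pt : ∀ v → f v * inc e v ≡ ⟦ a ≟ v ⟧ * f v + ⟦ b ≟ v ⟧ * f v
    pt v = trans (*-comm (f v) _) (*-distribʳ-+ (f v) ⟦ a ≟ v ⟧ ⟦ b ≟ v ⟧)

  -- The handshake identity with weights on vertices and edges.
  degree-sum : ∀ (f : Fin n → ℕ) (w : Fin m → ℕ) → sum (λ v → f v * sum λ e → w e * inc e v) ≡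
               sum (λ e → w e * (f (proj₁ (ends e)) + f (proj₂ (ends e))))
  degree-sum f w = begin
    sum (λ v → f v * sum λ e → w e * inc e v)    ≡⟨ sum-cong-≗ (λ v → *-distribˡ-sum (f v) (λ e → w e * inc e v)) ⟩
    sum (λ v → sum λ e → f v * (w e * inc e v))  ≡⟨ ∑-comm (λ v e → f v * (w e * inc e v)) ⟩
    sum (λ e → sum λ v → f v * (w e * inc e v))  ≡⟨ sum-cong-≗ (λ e → sum-cong-≗ λ v → shuffle (f v) (w e) (inc e v)) ⟩
    sum (λ e → sum λ v → w e * (f v * inc e v))  ≡⟨ sum-cong-≗ (λ e → *-distribˡ-sum (w e) (λ v → f v * inc e v)) ⟨
    sum (λ e → w e * sum λ v → f v * inc e v)    ≡⟨ sum-cong-≗ (λ e → cong (w e *_) (inc-sum f e)) ⟩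
    sum (λ e → w e * (f (proj₁ (ends e)) + f (proj₂ (ends e)))) ∎
    where
    open ≡-Reasoning
    shuffle : ∀ a b c → a * (b * c) ≡ b * (a * c)
    shuffle = solve-∀

  module Partition {χ : Colouring} (T : Trees χ) (B : Subset n)
    (together? : ∀ u v → Dec (Together χ B u v))
    (stable : ∀ e → χ e ≡ nothing → proj₁ (ends e) ∉ B → proj₂ (ends e) ∉ B → Together χ B (proj₁ (ends e)) (proj₂ (ends e)))
    {v₀ : Fin n} (v₀∉B : v₀ ∉ B) where

    private
      tr = transversal {X = ∁ B} together? (Together-refl ∘ x∈∁p⇒x∉p) Together-sym

    parts : ℕ
    parts = proj₁ tr

    rep : Fin parts → Fin n
    rep = proj₁ (proj₂ tr)

    rep∉B : ∀ i → rep i ∉ B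
    rep∉B i = x∈∁p⇒x∉p (proj₁ (proj₂ (proj₂ tr)) i)

    rep-inj : ∀ i j → Together χ B (rep i) (rep j) → i ≡ j
    rep-inj = proj₁ (proj₂ (proj₂ (proj₂ tr)))

    cover : ∀ {v} → v ∉ B → ∃ λ i → Together χ B v (rep i)
    cover v∉ = proj₂ (proj₂ (proj₂ (proj₂ tr))) (x∉p⇒x∈∁p v∉)

    -- The values on B are junk.
    label : Fin n → Fin parts
    label v with v ∈? B
    ... | no v∉ = proj₁ (cover v∉)
    ... | yes _ = proj₁ (cover v₀∉B)

    label-spec : ∀ {v} → v ∉ B → Together χ B v (rep (label v))
    label-spec {v} v∉ with v ∈? B
    ... | no v∉  = proj₂ (cover v∉)
    ... | yes v∈ = contradiction v∈ v∉

    label⇒together : ∀ {u v} → u ∉ B → v ∉ B → label u ≡ label v → Together χ B u v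
    label⇒together {u} {v} u∉ v∉ eq = Together-trans (label-spec u∉) (Together-sym (subst (λ i → Together χ B v (rep i)) (sym eq) (label-spec v∉)))

    together⇒label : ∀ {u v} → Together χ B u v → label u ≡ label v
    together⇒label t@(_ , av , _ , u∈ , v∈) = rep-inj _ _ (Together-trans (Together-sym (label-spec (av u∈))) (Together-trans t (label-spec (av v∈))))

    label-rep : ∀ i → label (rep i) ≡ i
    label-rep i = sym (rep-inj i _ (label-spec (rep∉B i)))

    P : Fin parts → Subset n
    P = Part G (∁ B) label

    ∈P⁺ : ∀ {i v} → v ∉ B → label v ≡ i → v ∈ P i
    ∈P⁺ {i} {v} v∉ eq = lookup⇒[]= v (P i) (trans (lookup∘tabulate _ v) h)
      where
      h : ⌊ v ∈? ∁ B ⌋ ∧ ⌊ label v ≟ i ⌋ ≡ true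
      h with v ∈? ∁ B | label v ≟ i
      ... | yes _ | yes _ = refl
      ... | yes _ | no ne = contradiction eq ne
      ... | no v∉∁ | _    = contradiction (x∉p⇒x∈∁p v∉) v∉∁

    ∈P⁻ : ∀ {i v} → v ∈ P i → v ∉ B × label v ≡ i
    ∈P⁻ {i} {v} v∈ with v ∈? ∁ B | label v ≟ i | trans (sym (lookup∘tabulate (λ v → ⌊ v ∈? ∁ B ⌋ ∧ ⌊ label v ≟ i ⌋) v)) ([]=⇒lookup v∈)
    ... | yes v∈∁ | yes eq | _ = x∈∁p⇒x∉p v∈∁ , eq
    ... | yes _   | no _   | ()
    ... | no _    | _      | ()

    -- A tight set that avoids `B` lies in a single class, so the set that joins two vertices of
    -- `P i` is contained in `P i`.
    P-tight : ∀ i → Tight χ (P i)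
    P-tight i j u∈ v∈ with ∈P⁻ u∈ | ∈P⁻ v∈
    ... | u∉ , lu | v∉ , lv with label⇒together u∉ v∉ (trans lu (sym lv))
    ...   | X , av , t , uX , vX = Conn-map (λ (c , ins) → c , inside-⊆ X⊆P ins) (t j uX vX)
      where
      X⊆P : X ⊆ P i
      X⊆P w∈ = ∈P⁺ (av w∈) (trans (together⇒label (X , av , t , w∈ , uX)) lu)

    same-label : ∀ j {u v} → u ∉ B → v ∉ B → label u ≡ label v →
                 Conn (λ e → Col χ j e × (proj₁ (ends e) ∉ B × proj₂ (ends e) ∉ B) × label (proj₁ (ends e)) ≡ label (proj₂ (ends e)) × label (proj₁ (ends e)) ≡ label v) u v
    same-label j u∉ v∉ eq with label⇒together u∉ v∉ eq
    ... | X , av , t , u∈ , v∈ = Conn-map (λ (c , a∈ , b∈) → c , (av a∈ , av b∈) , together⇒label (X , av , t , a∈ , b∈) , together⇒label (X , av , t , a∈ , v∈)) (t j u∈ v∈)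

    module _ (i : Fin parts) (Y : Subset n) (Y⊆ : Y ⊆ ∁ B) (P⊆Y : P i ⊆ Y) (tc : TreeConnected G 2 Y) where
      F : Fin 2 → Subset m
      F = proj₁ tc

      hull? : Decidable λ v → v ∉ B × ∃ λ y → y ∈ Y × label v ≡ label y
      hull? v = ¬? (v ∈? B) ×-dec any? λ y → (y ∈? Y) ×-dec (label v ≟ label y)

      H : Subset n
      H = subset hull?

      Y∉B : ∀ {y} → y ∈ Y → y ∉ B
      Y∉B = x∈∁p⇒x∉p ∘ Y⊆

      Y⊆H : Y ⊆ H
      Y⊆H y∈ = ∈-subset⁺ hull? (Y∉B y∈ , _ , y∈ , refl)

      rep∈Y : rep i ∈ Y
      rep∈Y = P⊆Y (∈P⁺ (rep∉B i) (label-rep i))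

      -- The trees of `Y` may ignore the colours of `χ`. This hybrid follows tree `j` of `Y` between
      -- classes and colour `j` of `χ` inside them. It connects `H`, the union of the classes that
      -- meet `Y`, so it has at least |H| - 1 edges. Together the two hybrids have no more edges
      -- than `χ` has inside `H`. Hence `H` is tight, and `Y` lies in one class.
      K : Fin 2 → Fin m → Set
      K j e = (e ∈ F j × label (proj₁ (ends e)) ≢ label (proj₂ (ends e))) ⊎
              (Within χ H j e × label (proj₁ (ends e)) ≡ label (proj₂ (ends e)))

      K? : ∀ j → Decidable (K j)
      K? j e = ((e ∈? F j) ×-dec ¬? l) ⊎-dec (Within? χ H j e ×-dec l)
        where l = label (proj₁ (ends e)) ≟ label (proj₂ (ends e))

      K-near : ∀ j {u y} → u ∉ B → y ∈ Y → label u ≡ label y → Conn (K j) u y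
      K-near j {u} {y} u∉ y∈ eq = Conn-map
        (λ (c , (a∉ , b∉) , l , ly) → inj₂ ((c , ∈-subset⁺ hull? (a∉ , y , y∈ , ly) , ∈-subset⁺ hull? (b∉ , y , y∈ , trans (sym l) ly)) , l))
        (same-label j u∉ (Y∉B y∈) eq)

      K-spans : ∀ j {u} → u ∈ H → Conn (K j) u (rep i)
      K-spans j u∈ with ∈-subset⁻ hull? u∈
      ... | u∉ , y , y∈ , eq = K-near j u∉ y∈ eq ◅◅ Conn-bind reroute (Reach⇒Conn (proj₁ (proj₂ (proj₁ (proj₂ tc) j)) y (rep i) y∈ rep∈Y))
        where
        reroute : ∀ e → e ∈ F j → Conn (K j) (proj₁ (ends e)) (proj₂ (ends e))
        reroute e e∈ with label (proj₁ (ends e)) ≟ label (proj₂ (ends e)) | proj₁ (proj₁ (proj₂ tc) j) e e∈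
        ... | yes l | a∈ , b∈ = K-near j (Y∉B a∈) b∈ l
        ... | no ¬l | _       = edge (inj₁ (e∈ , ¬l)) (inj₁ refl)

      0F 1F : Fin 2
      0F = zero
      1F = suc zero

      -- An edge of a tree of `Y` between two classes is coloured, by `stable`, but perhaps with the
      -- other colour; so only the sums over both colours can be compared.
      K-coloured : ∀ e → ⟦ K? 0F e ⟧ + ⟦ K? 1F e ⟧ ≤ ⟦ Within? χ H 0F e ⟧ + ⟦ Within? χ H 1F e ⟧
      K-coloured e = by-label (label (proj₁ (ends e)) ≟ label (proj₂ (ends e)))
        where
        W : ∀ j → Dec (Within χ H j e)
        W j = Within? χ H j e
        by-label : Dec (label (proj₁ (ends e)) ≡ label (proj₂ (ends e))) → ⟦ K? 0F e ⟧ + ⟦ K? 1F e ⟧ ≤ ⟦ W 0F ⟧ + ⟦ W 1F ⟧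
        by-label (yes l) = +-mono-≤ (⟦⟧-mono (K? 0F e) (W 0F) drop) (⟦⟧-mono (K? 1F e) (W 1F) drop)
          where
          drop : ∀ {j} → K j e → Within χ H j e
          drop = [ (λ (_ , ¬l) → contradiction l ¬l) , proj₁ ]′
        by-label (no ¬l) = by-tree (e ∈? F 0F) (e ∈? F 1F)
          where
          K⇒F : ∀ {j} → K j e → e ∈ F j
          K⇒F = [ proj₁ , (λ (_ , l) → contradiction l ¬l) ]′
          coloured : ∀ {j} → e ∈ F j → 1 ≤ ⟦ W 0F ⟧ + ⟦ W 1F ⟧
          coloured {j} e∈ with proj₁ (proj₁ (proj₂ tc) j) e e∈
          ... | a∈ , b∈ with colour χ e
          ...   | inj₁ eq = contradiction (together⇒label (stable e eq (Y∉B a∈) (Y∉B b∈))) ¬l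
          ...   | inj₂ (zero , eq) = ≤-trans (≤-reflexive (sym (⟦⟧-yes (Within? χ H 0F e) (eq , Y⊆H a∈ , Y⊆H b∈)))) (m≤m+n _ _)
          ...   | inj₂ (suc zero , eq) = ≤-trans (≤-reflexive (sym (⟦⟧-yes (Within? χ H 1F e) (eq , Y⊆H a∈ , Y⊆H b∈)))) (m≤n+m _ _)
          by-tree : Dec (e ∈ F 0F) → Dec (e ∈ F 1F) → ⟦ K? 0F e ⟧ + ⟦ K? 1F e ⟧ ≤ ⟦ W 0F ⟧ + ⟦ W 1F ⟧
          by-tree (yes e0) (yes e1) = contradiction e1 (proj₂ (proj₂ tc) 0F 1F (λ ()) e e0)
          by-tree (yes e0) (no ¬e1) = ≤-trans (+-mono-≤ (⟦⟧-mono (K? 0F e) (yes e0) K⇒F) (≤-reflexive (⟦⟧-no (K? 1F e) (¬e1 ∘ K⇒F)))) (coloured e0)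
          by-tree (no ¬e0) (yes e1) = ≤-trans (+-mono-≤ (≤-reflexive (⟦⟧-no (K? 0F e) (¬e0 ∘ K⇒F))) (⟦⟧-mono (K? 1F e) (yes e1) K⇒F)) (coloured e1)
          by-tree (no ¬e0) (no ¬e1) = ≤-trans (≤-reflexive (cong₂ _+_ (⟦⟧-no (K? 0F e) (¬e0 ∘ K⇒F)) (⟦⟧-no (K? 1F e) (¬e1 ∘ K⇒F)))) z≤n

      H-full : ∀ j → ∣ H ∣ ≤ size (Within? χ H j) + 1
      H-full j = each j
        where
        w : Fin 2 → ℕ
        w j = size (Within? χ H j)
        total : ∣ H ∣ + ∣ H ∣ ≤ (w 0F + 1) + (w 1F + 1)
        total = begin
          ∣ H ∣ + ∣ H ∣                         ≤⟨ +-mono-≤ (spanning-lower (K? 0F) (K-spans 0F)) (spanning-lower (K? 1F) (K-spans 1F)) ⟩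
          (size (K? 0F) + 1) + (size (K? 1F) + 1) ≡⟨ shuffle (size (K? 0F)) (size (K? 1F)) ⟩
          (size (K? 0F) + size (K? 1F)) + 2     ≡⟨ cong (_+ 2) (∑-distrib-+ (λ e → ⟦ K? 0F e ⟧) _) ⟨
          sum (λ e → ⟦ K? 0F e ⟧ + ⟦ K? 1F e ⟧) + 2 ≤⟨ +-monoˡ-≤ 2 (sum-mono K-coloured) ⟩
          sum (λ e → ⟦ Within? χ H 0F e ⟧ + ⟦ Within? χ H 1F e ⟧) + 2 ≡⟨ cong (_+ 2) (∑-distrib-+ (λ e → ⟦ Within? χ H 0F e ⟧) _) ⟩
          (w 0F + w 1F) + 2                     ≡⟨ shuffle (w 0F) (w 1F) ⟨
          (w 0F + 1) + (w 1F + 1)               ∎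
          where
          open ≤-Reasoning
          shuffle : ∀ a b → (a + 1) + (b + 1) ≡ (a + b) + 2
          shuffle = solve-∀
        bound : ∀ j → w j + 1 ≤ ∣ H ∣
        bound = forest-bound T (Y⊆H rep∈Y)
        each : ∀ j → ∣ H ∣ ≤ w j + 1
        each zero       = +-cancelʳ-≤ ∣ H ∣ ∣ H ∣ (w 0F + 1) (≤-trans total (+-monoʳ-≤ (w 0F + 1) (bound 1F)))
        each (suc zero) = +-cancelˡ-≤ ∣ H ∣ ∣ H ∣ (w 1F + 1) (≤-trans total (+-monoˡ-≤ (w 1F + 1) (bound 0F)))

      maximal : Y ⊆ P i
      maximal y∈ = ∈P⁺ (Y∉B y∈) (trans (together⇒label (H , (λ w∈ → proj₁ (∈-subset⁻ hull? w∈)) , (λ j → full⇒connected T j (H-full j)) , Y⊆H y∈ , Y⊆H rep∈Y)) (label-rep i))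

    components : ComponentPartition G 2 (∁ B)
    components = record
      { parts = parts ; label = label
      ; nonempty = λ i → rep i , x∉p⇒x∈∁p (rep∉B i) , label-rep i
      ; treeConn = λ i → tight⇒treeConnected T (P-tight i) (∈P⁺ (rep∉B i) (label-rep i))
      ; maximal = maximal }

    Inner : Fin 2 → Fin m → Set
    Inner j e = Col χ j e × (proj₁ (ends e) ∉ B × proj₂ (ends e) ∉ B) × label (proj₁ (ends e)) ≡ label (proj₂ (ends e))

    Inner? : ∀ j → Decidable (Inner j)
    Inner? j e = Col? χ j e ×-dec ((¬? (proj₁ (ends e) ∈? B) ×-dec ¬? (proj₂ (ends e) ∈? B)) ×-dec (label (proj₁ (ends e)) ≟ label (proj₂ (ends e))))

    -- In colour `j`, edges within classes lead every vertex outside `B` to the representative of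
    -- its class; a vertex of `B` represents itself.
    inner-count : ∀ j → n ≤ size (Inner? j) + (∣ B ∣ + parts)
    inner-count j = subst (λ t → n ≤ size (Inner? j) + t) total (dominating (Inner? j) r dom)
      where
      r : Fin n → ℕ
      r v = ⟦ v ∈? B ⟧ + sum λ i → ⟦ rep i ≟ v ⟧
      total : sum r ≡ ∣ B ∣ + parts
      total = begin
        sum r                                                        ≡⟨ ∑-distrib-+ (λ v → ⟦ v ∈? B ⟧) _ ⟩
        sum (λ v → ⟦ v ∈? B ⟧) + sum (λ v → sum λ i → ⟦ rep i ≟ v ⟧) ≡⟨ cong₂ _+_ (sym (card B)) (∑-comm λ v i → ⟦ rep i ≟ v ⟧) ⟩
        ∣ B ∣ + sum (λ i → sum λ v → ⟦ rep i ≟ v ⟧)                  ≡⟨ cong (∣ B ∣ +_) (trans (sum-cong-≗ λ i → sum-δ′ (rep i)) (sum-one parts)) ⟩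
        ∣ B ∣ + parts                                                ∎
        where open ≡-Reasoning
      dom : ∀ v → ∃ λ w → 1 ≤ r w × Conn (Inner j) v w
      dom v with v ∈? B
      ... | yes v∈ = v , ≤-trans (≤-reflexive (sym (⟦⟧-yes (v ∈? B) v∈))) (m≤m+n _ _) , ε
      ... | no v∉  = w , ≤-trans (≤-reflexive (sym (⟦⟧-yes (w ≟ w) refl))) (≤-trans (≤-sum (λ i → ⟦ rep i ≟ w ⟧) (label v)) (m≤n+m _ _)) ,
        Conn-map (λ (c , ∉B , l , _) → c , ∉B , l) (same-label j v∉ (rep∉B (label v)) (sym (label-rep (label v))))
        where w = rep (label v)

    cross : Fin m → ℕ
    cross e = if ⌊ proj₁ (ends e) ∈? ∁ B ⌋ ∧ ⌊ proj₂ (ends e) ∈? ∁ B ⌋ ∧ not ⌊ label (proj₁ (ends e)) ≟ label (proj₂ (ends e)) ⌋ then 1 else 0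

    -- An uncoloured edge contributes nothing on the left, as `stable` forbids it to cross. A
    -- coloured edge contributes at most 1, except that it contributes 2 when both ends are in `B`,
    -- and then `Within?` pays for the second.
    edge-count : ∀ e → used (χ e) * (⟦ proj₁ (ends e) ∈? B ⟧ + ⟦ proj₂ (ends e) ∈? B ⟧) + cross e + (⟦ Inner? zero e ⟧ + ⟦ Inner? (suc zero) e ⟧)
                     ≤ ⟦ Col? χ zero e ⟧ + ⟦ Col? χ (suc zero) e ⟧ + (⟦ Within? χ B zero e ⟧ + ⟦ Within? χ B (suc zero) e ⟧)
    edge-count e = by-colour (colour χ e)
      where
      a = proj₁ (ends e)
      b = proj₂ (ends e)
      Touching = used (χ e) * (⟦ a ∈? B ⟧ + ⟦ b ∈? B ⟧)
      Inners = ⟦ Inner? zero e ⟧ + ⟦ Inner? (suc zero) e ⟧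
      Cols = ⟦ Col? χ zero e ⟧ + ⟦ Col? χ (suc zero) e ⟧
      Withins = ⟦ Within? χ B zero e ⟧ + ⟦ Within? χ B (suc zero) e ⟧
      cross≤1 : cross e ≤ 1
      cross≤1 with ⌊ a ∈? ∁ B ⌋ ∧ ⌊ b ∈? ∁ B ⌋ ∧ not ⌊ label a ≟ label b ⌋
      ... | true  = ≤-refl
      ... | false = z≤n
      cross≡0 : (a ∉ B → b ∉ B → label a ≡ label b) → cross e ≡ 0
      cross≡0 h with a ∈? ∁ B | b ∈? ∁ B | label a ≟ label b
      ... | no _   | _      | _     = refl
      ... | yes _  | no _   | _     = refl
      ... | yes _  | yes _  | yes _ = refl
      ... | yes a∈ | yes b∈ | no ¬l = contradiction (h (x∈∁p⇒x∉p a∈) (x∈∁p⇒x∉p b∈)) ¬l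
      inners≡0 : (∀ {j} → ¬ Inner j e) → Inners ≡ 0
      inners≡0 h = cong₂ _+_ (⟦⟧-no (Inner? zero e) h) (⟦⟧-no (Inner? (suc zero) e) h)
      inners≤cols : Inners ≤ Cols
      inners≤cols = +-mono-≤ (⟦⟧-mono (Inner? zero e) (Col? χ zero e) proj₁) (⟦⟧-mono (Inner? (suc zero) e) (Col? χ (suc zero) e) proj₁)
      cols≥1 : ∀ {j} → Col χ j e → 1 ≤ Cols
      cols≥1 {zero}     c = ≤-trans (≤-reflexive (sym (⟦⟧-yes (Col? χ zero e) c))) (m≤m+n _ _)
      cols≥1 {suc zero} c = ≤-trans (≤-reflexive (sym (⟦⟧-yes (Col? χ (suc zero) e) c))) (m≤n+m _ _)
      withins≥1 : ∀ {j} → Within χ B j e → 1 ≤ Withins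
      withins≥1 {zero}     w = ≤-trans (≤-reflexive (sym (⟦⟧-yes (Within? χ B zero e) w))) (m≤m+n _ _)
      withins≥1 {suc zero} w = ≤-trans (≤-reflexive (sym (⟦⟧-yes (Within? χ B (suc zero) e) w))) (m≤n+m _ _)
      combine : ∀ {t c i s} → Touching ≡ t → cross e ≤ c → Inners ≤ i → t + c + i ≤ s → Touching + cross e + Inners ≤ s
      combine refl c≤ i≤ le = ≤-trans (+-mono-≤ (+-monoʳ-≤ Touching c≤) i≤) le
      by-colour : χ e ≡ nothing ⊎ (∃ λ j → Col χ j e) → Touching + cross e + Inners ≤ Cols + Withins
      by-colour (inj₁ free) = combine (cong (λ c → used c * (⟦ a ∈? B ⟧ + ⟦ b ∈? B ⟧)) free)
        (≤-reflexive (cross≡0 λ a∉ b∉ → together⇒label (stable e free a∉ b∉)))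
        (≤-reflexive (inners≡0 λ (c , _) → contradiction (trans (sym free) c) λ ())) z≤n
      by-colour (inj₂ (j , c)) = by-ends (a ∈? B) (b ∈? B) (label a ≟ label b)
        where
        touching : ∀ {x y} → ⟦ a ∈? B ⟧ ≡ x → ⟦ b ∈? B ⟧ ≡ y → Touching ≡ x + y
        touching refl refl = trans (cong (λ c → used c * (⟦ a ∈? B ⟧ + ⟦ b ∈? B ⟧)) c) (+-identityʳ _)
        by-ends : Dec (a ∈ B) → Dec (b ∈ B) → Dec (label a ≡ label b) → Touching + cross e + Inners ≤ Cols + Withins
        by-ends (yes a∈) (yes b∈) _ = combine (touching (⟦⟧-yes (a ∈? B) a∈) (⟦⟧-yes (b ∈? B) b∈))
          (≤-reflexive (cross≡0 λ a∉ _ → contradiction a∈ a∉)) (≤-reflexive (inners≡0 λ (_ , (a∉ , _) , _) → a∉ a∈)) (+-mono-≤ (cols≥1 c) (withins≥1 (c , a∈ , b∈)))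
        by-ends (yes a∈) (no b∉) _ = combine (touching (⟦⟧-yes (a ∈? B) a∈) (⟦⟧-no (b ∈? B) b∉))
          (≤-reflexive (cross≡0 λ a∉ _ → contradiction a∈ a∉)) (≤-reflexive (inners≡0 λ (_ , (a∉ , _) , _) → a∉ a∈)) (≤-trans (cols≥1 c) (m≤m+n _ _))
        by-ends (no a∉) (yes b∈) _ = combine (touching (⟦⟧-no (a ∈? B) a∉) (⟦⟧-yes (b ∈? B) b∈))
          (≤-reflexive (cross≡0 λ _ b∉ → contradiction b∈ b∉)) (≤-reflexive (inners≡0 λ (_ , (_ , b∉) , _) → b∉ b∈)) (≤-trans (cols≥1 c) (m≤m+n _ _))
        by-ends (no a∉) (no b∉) (yes l) = combine (touching (⟦⟧-no (a ∈? B) a∉) (⟦⟧-no (b ∈? B) b∉))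
          (≤-reflexive (cross≡0 λ _ _ → l)) inners≤cols (m≤m+n _ _)
        by-ends (no a∉) (no b∉) (no ¬l) = combine (touching (⟦⟧-no (a ∈? B) a∉) (⟦⟧-no (b ∈? B) b∉))
          cross≤1 (≤-reflexive (inners≡0 λ (_ , _ , l) → ¬l l)) (≤-trans (cols≥1 c) (m≤m+n _ _))

    -- Of the 4, two units come from the sizes n - 1 of the trees, and two from the forests inside
    -- `B`, which have at most |B| - 1 edges each because `B` is nonempty.
    degree-count : ∀ {z} → z ∈ B → sum (λ v → ⟦ v ∈? B ⟧ * deg χ v) + crossing G (∁ B) label + 4 ≤ 4 * ∣ B ∣ + 2 * parts
    degree-count z∈ = +-cancelʳ-≤ (I zero + I (suc zero)) (S + cr + 4) (4 * ∣ B ∣ + 2 * parts) (begin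
      S + cr + 4 + (I zero + I (suc zero))  ≡⟨ shuffle₁ S cr (I zero + I (suc zero)) ⟩
      S + cr + (I zero + I (suc zero)) + 4  ≤⟨ +-monoˡ-≤ 4 total ⟩
      C zero + C (suc zero) + (W zero + W (suc zero)) + 4 ≡⟨ shuffle₂ (C zero) (C (suc zero)) (W zero) (W (suc zero)) ⟩
      (C zero + 1) + (C (suc zero) + 1) + ((W zero + 1) + (W (suc zero) + 1)) ≤⟨ +-mono-≤ (+-mono-≤ (col zero) (col (suc zero))) (+-mono-≤ (forest-bound T z∈ zero) (forest-bound T z∈ (suc zero))) ⟩
      (I zero + (∣ B ∣ + parts)) + (I (suc zero) + (∣ B ∣ + parts)) + (∣ B ∣ + ∣ B ∣) ≡⟨ shuffle₃ (I zero) (I (suc zero)) ∣ B ∣ parts ⟩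
      4 * ∣ B ∣ + 2 * parts + (I zero + I (suc zero)) ∎)
      where
      open ≤-Reasoning
      I C W : Fin 2 → ℕ
      I j = size (Inner? j)
      C j = size (Col? χ j)
      W j = size (Within? χ B j)
      S = sum (λ v → ⟦ v ∈? B ⟧ * deg χ v)
      cr = crossing G (∁ B) label
      col : ∀ j → C j + 1 ≤ I j + (∣ B ∣ + parts)
      col j = ≤-trans (≤-reflexive (proj₂ (T j))) (inner-count j)
      shuffle₁ : ∀ a b c → a + b + 4 + c ≡ a + b + c + 4
      shuffle₁ = solve-∀
      shuffle₂ : ∀ a b c d → a + b + (c + d) + 4 ≡ (a + 1) + (b + 1) + ((c + 1) + (d + 1))
      shuffle₂ = solve-∀
      shuffle₃ : ∀ i j b p → (i + (b + p)) + (j + (b + p)) + (b + b) ≡ 4 * b + 2 * p + (i + j)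
      shuffle₃ = solve-∀
      t : Fin m → ℕ
      t e = used (χ e) * (⟦ proj₁ (ends e) ∈? B ⟧ + ⟦ proj₂ (ends e) ∈? B ⟧)
      pair : ∀ f g → sum f + sum g ≡ sum (λ (e : Fin m) → f e + g e)
      pair f g = sym (∑-distrib-+ f g)
      total : S + cr + (I zero + I (suc zero)) ≤ C zero + C (suc zero) + (W zero + W (suc zero))
      total = begin
        S + cr + (I zero + I (suc zero))
          ≡⟨ cong₂ _+_ (cong₂ _+_ (degree-sum (λ v → ⟦ v ∈? B ⟧) (used ∘ χ)) (card-tabulate λ e → ⌊ proj₁ (ends e) ∈? ∁ B ⌋ ∧ ⌊ proj₂ (ends e) ∈? ∁ B ⌋ ∧ not ⌊ label (proj₁ (ends e)) ≟ label (proj₂ (ends e)) ⌋)) (pair _ _) ⟩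
        sum t + sum cross + sum (λ e → ⟦ Inner? zero e ⟧ + ⟦ Inner? (suc zero) e ⟧)
          ≡⟨ trans (cong (_+ sum λ e → ⟦ Inner? zero e ⟧ + ⟦ Inner? (suc zero) e ⟧) (pair t cross)) (pair _ _) ⟩
        sum (λ e → t e + cross e + (⟦ Inner? zero e ⟧ + ⟦ Inner? (suc zero) e ⟧))
          ≤⟨ sum-mono edge-count ⟩
        sum (λ e → ⟦ Col? χ zero e ⟧ + ⟦ Col? χ (suc zero) e ⟧ + (⟦ Within? χ B zero e ⟧ + ⟦ Within? χ B (suc zero) e ⟧))
          ≡⟨ trans (cong₂ _+_ (pair _ _) (pair _ _)) (pair _ _) ⟨
        C zero + C (suc zero) + (W zero + W (suc zero)) ∎

  -- Degree-bounded pairs of spanning trees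

  module Existence (f : Fin n → ℕ)
    (condition : ∀ (S : Subset n) (P : ComponentPartition G 2 (∁ S)) →
      Ω G P ℤ.≤ sumOver G S (λ v → ℤ.+ 2 ℤ.* ℤ.+ f v ℤ.- ℤ.+ 3) ℤ.+ ℤ.+ 4) where

    condition-ℕ : ∀ S (P : ComponentPartition G 2 (∁ S)) →
      2 * ComponentPartition.parts P + sum (λ v → ⟦ v ∈? S ⟧ * 3) ≤
      sum (λ v → ⟦ v ∈? S ⟧ * (2 * f v)) + 4 + crossing G (∁ S) (ComponentPartition.label P)
    condition-ℕ S P = ℤ.drop‿+≤+ (begin
      ℤ.+ (p + b)                     ≡⟨ shuffle₁ (ℤ.+ p) (ℤ.+ c) (ℤ.+ b) ⟩
      ℤ.+ p ℤ.- ℤ.+ c ℤ.+ ℤ.+ (b + c) ≤⟨ ℤ.+-monoˡ-≤ (ℤ.+ (b + c)) (condition S P) ⟩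
      s ℤ.+ ℤ.+ 4 ℤ.+ ℤ.+ (b + c)     ≡⟨ shuffle₂ s (ℤ.+ b) (ℤ.+ c) ⟩
      s ℤ.+ ℤ.+ b ℤ.+ ℤ.+ 4 ℤ.+ ℤ.+ c ≡⟨ cong (λ y → y ℤ.+ ℤ.+ 4 ℤ.+ ℤ.+ c) (sumOver-affine G S f) ⟩
      ℤ.+ (t + 4 + c)                 ∎)
      where
      open ℤ.≤-Reasoning
      p = 2 * ComponentPartition.parts P
      b = sum (λ v → ⟦ v ∈? S ⟧ * 3)
      c = crossing G (∁ S) (ComponentPartition.label P)
      s = sumOver G S (λ v → ℤ.+ 2 ℤ.* ℤ.+ f v ℤ.- ℤ.+ 3)
      t = sum (λ v → ⟦ v ∈? S ⟧ * (2 * f v))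
      shuffle₁ : ∀ p c b → p ℤ.+ b ≡ p ℤ.- c ℤ.+ (b ℤ.+ c)
      shuffle₁ = ℤ-solve-∀
      shuffle₂ : ∀ s b c → s ℤ.+ ℤ.+ 4 ℤ.+ (b ℤ.+ c) ≡ s ℤ.+ b ℤ.+ ℤ.+ 4 ℤ.+ c
      shuffle₂ = ℤ-solve-∀

    η : Fin n → ℕ
    η v = suc (2 * f v)

    Stable : Colouring → Subset n → Set
    Stable χ B = ∀ e → χ e ≡ nothing → proj₁ (ends e) ∉ B → proj₂ (ends e) ∉ B → Together χ B (proj₁ (ends e)) (proj₂ (ends e))

    obstruction : ∀ {χ B x v₀} → Trees χ → (∀ u v → Dec (Together χ B u v)) → Stable χ B → v₀ ∉ B →
                  (∀ {v} → v ∈ B → η v ≤ deg χ v) → x ∈ B → η x < deg χ x → ⊥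
    obstruction {χ} {B} {x} T together? stable v₀∉ high x∈ over = <-irrefl refl (begin-strict
      F + b + (s + c + 4)       ≡⟨ cong (_+ (s + c + 4)) (sym weights) ⟩
      w + (s + c + 4)           <⟨ +-monoˡ-< (s + c + 4) weights< ⟩
      s + (s + c + 4)           ≤⟨ +-monoʳ-≤ s (degree-count x∈) ⟩
      s + (4 * ∣ B ∣ + 2 * parts) ≡⟨ cong (λ y → s + (4 * y + 2 * parts)) (card B) ⟩
      s + (4 * b + 2 * parts)   ≡⟨ shuffle₁ s b parts ⟩
      s + b + (2 * parts + 3 * b) ≤⟨ +-monoʳ-≤ (s + b) (subst (λ y → 2 * parts + y ≤ F + 4 + c) triple (condition-ℕ B components)) ⟩
      s + b + (F + 4 + c)       ≡⟨ shuffle₂ s b F c ⟩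
      F + b + (s + c + 4)       ∎)
      where
      open ≤-Reasoning
      open Partition T B together? stable v₀∉ using (parts; label; components; degree-count)
      F = sum (λ v → ⟦ v ∈? B ⟧ * (2 * f v))
      b = sum (λ v → ⟦ v ∈? B ⟧)
      s = sum (λ v → ⟦ v ∈? B ⟧ * deg χ v)
      c = crossing G (∁ B) label
      w = sum (λ v → ⟦ v ∈? B ⟧ * η v)
      triple : sum (λ v → ⟦ v ∈? B ⟧ * 3) ≡ 3 * b
      triple = trans (sum-cong-≗ λ v → *-comm ⟦ v ∈? B ⟧ 3) (sym (*-distribˡ-sum 3 (λ v → ⟦ v ∈? B ⟧)))
      weights : w ≡ F + b
      weights = trans (sum-cong-≗ λ v → trans (*-suc ⟦ v ∈? B ⟧ (2 * f v)) (+-comm ⟦ v ∈? B ⟧ _)) (∑-distrib-+ (λ v → ⟦ v ∈? B ⟧ * (2 * f v)) _)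
      weights≤ : ∀ v → ⟦ v ∈? B ⟧ * η v ≤ ⟦ v ∈? B ⟧ * deg χ v
      weights≤ v with v ∈? B
      ... | yes v∈ = +-monoˡ-≤ 0 (high v∈)
      ... | no _   = z≤n
      weights<x : ⟦ x ∈? B ⟧ * η x < ⟦ x ∈? B ⟧ * deg χ x
      weights<x rewrite ⟦⟧-yes (x ∈? B) x∈ = +-monoˡ-< 0 over
      weights< : w < s
      weights< = sum-mono-< weights≤ x weights<x
      shuffle₁ : ∀ s b p → s + (4 * b + 2 * p) ≡ s + b + (2 * p + 3 * b)
      shuffle₁ = solve-∀
      shuffle₂ : ∀ s b F c → s + b + (F + 4 + c) ≡ F + b + (s + c + 4)
      shuffle₂ = solve-∀

    incident-edge : ∀ {χ x} → 1 ≤ deg χ x → ∃ λ e → ∃ λ y → Joins G e x y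
    incident-edge {χ} {x} pos with any? (λ e → (proj₁ (ends e) ≟ x) ⊎-dec (proj₂ (ends e) ≟ x))
    ... | yes (e , inj₁ refl) = e , _ , inj₁ refl
    ... | yes (e , inj₂ refl) = e , _ , inj₂ refl
    ... | no none = contradiction (≤-trans pos (≤-reflexive (sum-zero λ e →
        trans (cong (used (χ e) *_) (cong₂ _+_ (⟦⟧-no (proj₁ (ends e) ≟ x) λ eq → none (e , inj₁ eq)) (⟦⟧-no (proj₂ (ends e) ≟ x) λ eq → none (e , inj₂ eq)))) (*-zeroʳ (used (χ e)))))) λ ()

    loop-free : ∀ {e x} → ¬ Joins G e x x
    loop-free {e} (inj₁ eq) = loopless e (trans (cong proj₁ eq) (sym (cong proj₂ eq)))
    loop-free {e} (inj₂ eq) = loopless e (trans (cong proj₁ eq) (sym (cong proj₂ eq)))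

    ¬¬-together? : ∀ χ B → ¬ ¬ (∀ u v → Dec (Together χ B u v))
    ¬¬-together? χ B = ¬¬-∀ λ u → ¬¬-∀ λ v → ¬¬-excluded-middle

    -- If B is everything, leave out one vertex other than x: the condition says
    -- nothing about S = ⊤, as no labelling by parts of the empty set exists.
    obstruction′ : ∀ {χ B x} → Trees χ → (∀ u v → Dec (Together χ B u v)) → Stable χ B →
                   (∀ {v} → v ∈ B → η v ≤ deg χ v) → x ∈ B → η x < deg χ x → ⊥
    obstruction′ {χ} {B} {x} T together? stable high x∈ over with any? (λ v → ¬? (v ∈? B))
    ... | yes (v₀ , v₀∉) = obstruction T together? stable v₀∉ high x∈ over
    -- The omitted vertex is a neighbour of `x`: the degree of `x` is positive, and a neighbour
    -- differs from `x` as there are no loops.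
    ... | no none with incident-edge {χ} {x} (≤-trans (s≤s z≤n) over)
    ...   | e , y , j = ¬¬-together? χ (∁ ⁅ y ⁆) λ together?′ →
      obstruction T together?′ stable′ (λ y∈ → x∈∁p⇒x∉p y∈ (x∈⁅x⁆ y)) (λ {v} _ → high (everywhere v)) x∈′ over
      where
      everywhere : ∀ v → v ∈ B
      everywhere v with v ∈? B
      ... | yes v∈ = v∈
      ... | no v∉  = contradiction (v , v∉) none
      stable′ : Stable χ (∁ ⁅ y ⁆)
      stable′ e _ a∉ b∉ = contradiction (trans (x∈⁅y⁆⇒x≡y y (x∉∁p⇒x∈p a∉)) (sym (x∈⁅y⁆⇒x≡y y (x∉∁p⇒x∈p b∉)))) (loopless e)
      x∈′ : x ∈ ∁ ⁅ y ⁆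
      x∈′ = x∉p⇒x∈∁p λ x∈y → loop-free (subst (λ z → Joins G e z y) (x∈⁅y⁆⇒x≡y y x∈y) j)

    excess : Colouring → ℕ
    excess χ = sum λ v → deg χ v ∸ η v

    -- A degree of at most the maximum of `η v` and `deg χ v` cannot raise the truncated excess at
    -- `v`. At `x` this maximum is `deg χ x`, so a smaller degree lowers the excess there.
    improve : ∀ {χ x} → η x < deg χ x → ∀ {B} → Reducible χ (λ v → η v ⊔ deg χ v) B x →
              ∃ λ χ′ → Trees χ′ × excess χ′ < excess χ
    improve {χ} {x} over R = χ′ , trees′ , sum-mono-< (λ v → below v) x strict
      where
      open Reducible R
      below : ∀ v → deg χ′ v ∸ η v ≤ deg χ v ∸ η v
      below v = m≤n+o⇒m∸n≤o _ (η v) (≤-trans (deg≤ v) (⊔-lub (m≤m+n (η v) _) (m≤n+m∸n (deg χ v) (η v))))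
      strict : deg χ′ x ∸ η x < deg χ x ∸ η x
      strict = m<n+o⇒m∸n<o (deg χ′ x) (η x) {{>-nonZero (m<n⇒0<n∸m over)}} (begin-strict
        deg χ′ x              <⟨ deg< ⟩
        η x ⊔ deg χ x         ≡⟨ m≤n⇒m⊔n≡n (<⇒≤ over) ⟩
        deg χ x               ≡⟨ m+[n∸m]≡n (<⇒≤ over) ⟨
        η x + (deg χ x ∸ η x) ∎)
        where open ≤-Reasoning

    Good : Colouring → Set
    Good χ = Trees χ × ∀ v → deg χ v ≤ η v

    module _ {χ : Colouring} (T : Trees χ) {x : Fin n} (over : η x < deg χ x)
      (minimal : ∀ {χ′} → Trees χ′ → ¬ excess χ′ < excess χ) where

      M : Fin n → ℕ
      M v = η v ⊔ deg χ v

      shrink-all : ∀ k B → ∣ B ∣ ≤ k → (∀ {v} → v ∈ B → η v ≤ deg χ v) → (∀ {v} → v ∉ B → Reducible χ M B v) → ⊥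
      shrink-all k B size high red = ¬¬-together? χ B go
        where
        apart? : (∀ u v → Dec (Together χ B u v)) → ∀ e → Dec (χ e ≡ nothing × (proj₁ (ends e) ∉ B × proj₂ (ends e) ∉ B) × ¬ Together χ B (proj₁ (ends e)) (proj₂ (ends e)))
        apart? together? e = (χ e ≟ᶜ nothing) ×-dec (¬? (proj₁ (ends e) ∈? B) ×-dec ¬? (proj₂ (ends e) ∈? B)) ×-dec ¬? (together? _ _)
        next-step : ∀ k → ∣ B ∣ ≤ k → (∃ λ B′ → B′ ⊂ B × (∀ {v} → v ∉ B′ → Reducible χ M B′ v)) → ⊥
        next-step zero le (B′ , sub , _) = contradiction (<-≤-trans (p⊂q⇒∣p∣<∣q∣ sub) le) λ ()
        next-step (suc k) le (B′ , sub , red′) = shrink-all k B′ (s≤s⁻¹ (≤-trans (p⊂q⇒∣p∣<∣q∣ sub) le)) (λ v∈ → high (proj₁ sub v∈)) red′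
        go : ¬ (∀ u v → Dec (Together χ B u v))
        go together? with any? (apart? together?)
        ... | yes (e , free , (a∉ , b∉) , apart) = ¬¬-∀ (λ _ → ¬¬-excluded-middle) λ touched? → next-step k size (Step.shrink T (red a∉) (red b∉) free apart touched? red)
        -- The class structure is now stable. Outside `B`, `x` is reducible, against minimality;
        -- inside `B`, the count applies.
        ... | no none with x ∈? B
        ...   | no x∉ = let χ′ , T′ , less = improve over (red x∉) in minimal T′ less
        ...   | yes x∈ = obstruction′ T together? stable high x∈ over
          where
          stable : Stable χ B
          stable e free a∉ b∉ with together? (proj₁ (ends e)) (proj₂ (ends e))
          ... | yes t = t
          ... | no ¬t = contradiction (e , free , (a∉ , b∉) , ¬t) none

      not-minimal : ⊥
      not-minimal = shrink-all ∣ B₀ ∣ B₀ ≤-refl (∈-subset⁻ high?) start-red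
        where
        high? : Decidable λ v → η v ≤ deg χ v
        high? v = η v ≤? deg χ v
        B₀ = subset high?
        -- Here `χ` itself serves as the recolouring: the degree of `v` is already below `η v`.
        start-red : ∀ {v} → v ∉ B₀ → Reducible χ M B₀ v
        start-red {v} v∉ = record
          { X = ⁅ v ⁆ ; χ′ = χ ; avoids = λ w∈ → subst (_∉ B₀) (sym (x∈⁅y⁆⇒x≡y v w∈)) v∉ ; v∈X = x∈⁅x⁆ v
          ; tight = tight-singleton v ; tight′ = tight-singleton v ; trees′ = T ; agree = λ _ → inj₂ refl
          ; deg≤ = λ w → m≤n⊔m (η w) (deg χ w)
          ; deg< = <-≤-trans (≰⇒> λ le → v∉ (∈-subset⁺ high? le)) (m≤m⊔n (η v) (deg χ v)) }

    -- Descent on the excess replaces the choice of a minimum: under `¬good`, every colouring of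
    -- smaller excess is contradictory, and this is the minimality that `not-minimal` asks for.
    good-exists : ∀ k {χ} → Trees χ → excess χ ≤ k → ¬ ¬ ∃ Good
    good-exists k {χ} T le ¬good with any? (λ v → η v <? deg χ v)
    ... | no none = ¬good (χ , T , λ v → ≮⇒≥ λ lt → none (v , lt))
    ... | yes (x , over) = not-minimal T over λ T′ less → descend k le T′ less
      where
      descend : ∀ k → excess χ ≤ k → ∀ {χ′} → Trees χ′ → ¬ excess χ′ < excess χ
      descend zero le _ less = contradiction (<-≤-trans less le) λ ()
      descend (suc k) le T′ less = good-exists k T′ (s≤s⁻¹ (≤-trans less le)) ¬good

  -- Spanning closed trails

  wdeg : (Fin m → ℕ) → Fin n → ℕ
  wdeg w v = sum λ e → w e * inc e v

  Joins-inc : ∀ {e u v} → Joins G e u v → ∀ x → inc e x ≡ ⟦ u ≟ x ⟧ + ⟦ v ≟ x ⟧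
  Joins-inc (inj₁ eq) x = cong₂ (λ a b → ⟦ a ≟ x ⟧ + ⟦ b ≟ x ⟧) (cong proj₁ eq) (cong proj₂ eq)
  Joins-inc {u = u} {v} (inj₂ eq) x = trans (cong₂ (λ a b → ⟦ a ≟ x ⟧ + ⟦ b ≟ x ⟧) (cong proj₁ eq) (cong proj₂ eq)) (+-comm ⟦ v ≟ x ⟧ ⟦ u ≟ x ⟧)

  mult : ∀ {P u v} → Conn P u v → Fin m → ℕ
  mult ε x = 0
  mult ((e , _) ◅ c) x = ⟦ e ≟ x ⟧ + mult c x

  starts : ∀ {P u v} → Conn P u v → Fin n → ℕ
  starts ε x = 0
  starts (_◅_ {i = u} _ c) x = ⟦ u ≟ x ⟧ + starts c x

  mult-sum : ∀ {P u v w} (s : Adj P u v) (c : Conn P v w) (g : Fin m → ℕ) →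
             sum (λ x → mult (s ◅ c) x * g x) ≡ g (proj₁ s) + sum (λ x → mult c x * g x)
  mult-sum (e , _) c g = trans (sum-cong-≗ λ x → *-distribʳ-+ (g x) ⟦ e ≟ x ⟧ (mult c x))
    (trans (∑-distrib-+ (λ x → ⟦ e ≟ x ⟧ * g x) _) (cong (_+ sum λ x → mult c x * g x) (sum-pick e g)))

  -- Departures from `x` and arrivals at `x` balance, up to the two ends of the walk. This gives
  -- both the parity of walks and, for closed ones, a degree of twice the number of visits.
  walk-degree : ∀ {P u v} (c : Conn P u v) x → wdeg (mult c) x + ⟦ u ≟ x ⟧ ≡ 2 * starts c x + ⟦ v ≟ x ⟧
  walk-degree {u = u} ε x = cong (_+ ⟦ u ≟ x ⟧) (sum-zero {m} λ _ → refl)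
  walk-degree {u = u} {v} (_◅_ {j = w} (e , p , j) c) x = begin
    wdeg (mult ((e , p , j) ◅ c)) x + ⟦ u ≟ x ⟧             ≡⟨ cong (_+ ⟦ u ≟ x ⟧) (mult-sum (e , p , j) c (λ e → inc e x)) ⟩
    inc e x + wdeg (mult c) x + ⟦ u ≟ x ⟧                   ≡⟨ cong (λ y → y + wdeg (mult c) x + ⟦ u ≟ x ⟧) (Joins-inc j x) ⟩
    ⟦ u ≟ x ⟧ + ⟦ w ≟ x ⟧ + wdeg (mult c) x + ⟦ u ≟ x ⟧     ≡⟨ shuffle₁ ⟦ u ≟ x ⟧ ⟦ w ≟ x ⟧ (wdeg (mult c) x) ⟩
    2 * ⟦ u ≟ x ⟧ + (wdeg (mult c) x + ⟦ w ≟ x ⟧)           ≡⟨ cong (2 * ⟦ u ≟ x ⟧ +_) (walk-degree c x) ⟩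
    2 * ⟦ u ≟ x ⟧ + (2 * starts c x + ⟦ v ≟ x ⟧)            ≡⟨ shuffle₂ ⟦ u ≟ x ⟧ (starts c x) ⟦ v ≟ x ⟧ ⟩
    2 * (⟦ u ≟ x ⟧ + starts c x) + ⟦ v ≟ x ⟧                ∎
    where
    open ≡-Reasoning
    shuffle₁ : ∀ a b c → a + b + c + a ≡ 2 * a + (c + b)
    shuffle₁ = solve-∀
    shuffle₂ : ∀ a b c → 2 * a + (2 * b + c) ≡ 2 * (a + b) + c
    shuffle₂ = solve-∀

  mult-∉ : ∀ {P u v} (c : Conn P u v) {x} → ¬ P x → mult c x ≡ 0
  mult-∉ ε _ = refl
  mult-∉ ((e , p , _) ◅ c) {x} ¬p = cong₂ _+_ (⟦⟧-no (e ≟ x) λ { refl → ¬p p }) (mult-∉ c ¬p)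

  -- The subgraph consists of the first tree and of the edges used an odd number
  -- of times by the walks that join every v, deg v times, to a root within the
  -- second tree; each of these walks only affects the parities at its ends.
  even-subgraph : ∀ {χ} → (∀ i u v → Conn (Col χ i) u v) → Fin n →
                  ∃ λ (K : Fin m → ℕ) → (∀ {e} → Col χ zero e → K e ≡ 1) × (∀ e → K e ≤ used (χ e)) × (∀ x → Even (wdeg K x))
  even-subgraph {χ} con r = K , K-tree , K≤ , K-even
    where
    c : Fin m → ℕ
    c e = ⟦ Col? χ zero e ⟧
    d : Fin n → ℕ
    d = wdeg c
    p : ∀ v → Conn (Col χ (suc zero)) v r
    p v = con (suc zero) v r
    w : Fin m → ℕ
    w e = c e + sum λ v → d v * mult (p v) e
    K : Fin m → ℕ
    K e = residue (parity (w e))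
    A : Fin n → ℕ
    A x = sum λ v → d v * wdeg (mult (p v)) x
    outside-second : ∀ {e} → ¬ Col χ (suc zero) e → w e ≡ c e
    outside-second {e} ¬c = trans (cong (c e +_) (sum-zero λ v → trans (cong (d v *_) (mult-∉ (p v) ¬c)) (*-zeroʳ (d v)))) (+-identityʳ _)
    K-tree : ∀ {e} → Col χ zero e → K e ≡ 1
    K-tree {e} c0 = cong (residue ∘ parity) (trans (outside-second λ c1 → contradiction (trans (sym c0) c1) λ ()) (⟦⟧-yes (Col? χ zero e) c0))
    K≤ : ∀ e → K e ≤ used (χ e)
    K≤ e with colour χ e
    ... | inj₂ (_ , eq) = subst (λ y → K e ≤ used y) (sym eq) (residue≤1 (parity (w e)))
    ... | inj₁ eq = ≤-trans (≤-reflexive (cong (residue ∘ parity) (trans (outside-second λ c1 → none c1) (⟦⟧-no (Col? χ zero e) none)))) z≤n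
      where
      none : ∀ {i} → ¬ Col χ i e
      none ci = contradiction (trans (sym eq) ci) λ ()
    d-total-even : Even (sum d)
    d-total-even = subst Even (sym (trans (sum-cong-≗ λ v → sym (*-identityˡ (d v))) (trans (degree-sum (λ _ → 1) c) (∑-double c)))) (even-double (sum c))
      where
      ∑-double : ∀ (c : Fin m → ℕ) → sum (λ e → c e * 2) ≡ sum c + sum c
      ∑-double c = trans (sum-cong-≗ λ e → trans (*-comm (c e) 2) (cong (c e +_) (+-identityʳ _))) (∑-distrib-+ c c)
    -- Modulo 2, the `d v` walks from `v` add `d v` at `v` and `d v` at the root. The former cancels
    -- the degree in the first tree; the latter sums to the total degree of that tree, which is
    -- even.
    A-even : ∀ x → Even (d x + A x)
    A-even x = even-cancel (⟦ r ≟ x ⟧ * sum d) (even-* ⟦ r ≟ x ⟧ d-total-even) (subst Even eq (even-sum λ v → even-* (d v) (walk-even v)))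
      where
      walk-even : ∀ v → Even (wdeg (mult (p v)) x + ⟦ v ≟ x ⟧ + ⟦ r ≟ x ⟧)
      walk-even v = subst Even (trans (sym (+-assoc (2 * starts (p v) x) _ _)) (cong (_+ ⟦ r ≟ x ⟧) (sym (walk-degree (p v) x))))
        (even-+ (subst Even (cong (starts (p v) x +_) (sym (+-identityʳ _))) (even-double (starts (p v) x))) (even-double ⟦ r ≟ x ⟧))
      eq : sum (λ v → d v * (wdeg (mult (p v)) x + ⟦ v ≟ x ⟧ + ⟦ r ≟ x ⟧)) ≡ d x + A x + ⟦ r ≟ x ⟧ * sum d
      eq = begin
        sum (λ v → d v * (wdeg (mult (p v)) x + ⟦ v ≟ x ⟧ + ⟦ r ≟ x ⟧))
          ≡⟨ sum-cong-≗ (λ v → expand (d v) (wdeg (mult (p v)) x) ⟦ v ≟ x ⟧ ⟦ r ≟ x ⟧) ⟩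
        sum (λ v → ⟦ v ≟ x ⟧ * d v + d v * wdeg (mult (p v)) x + ⟦ r ≟ x ⟧ * d v)
          ≡⟨ trans (∑-distrib-+ (λ v → ⟦ v ≟ x ⟧ * d v + d v * wdeg (mult (p v)) x) _) (cong (_+ sum λ v → ⟦ r ≟ x ⟧ * d v) (∑-distrib-+ (λ v → ⟦ v ≟ x ⟧ * d v) _)) ⟩
        sum (λ v → ⟦ v ≟ x ⟧ * d v) + A x + sum (λ v → ⟦ r ≟ x ⟧ * d v)
          ≡⟨ cong₂ (λ a b → a + A x + b) (trans (sum-cong-≗ λ v → cong (_* d v) (⟦⟧-cong (v ≟ x) (x ≟ v) sym sym)) (sum-pick x d)) (sym (*-distribˡ-sum ⟦ r ≟ x ⟧ d)) ⟩
        d x + A x + ⟦ r ≟ x ⟧ * sum d ∎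
        where
        open ≡-Reasoning
        expand : ∀ d a b c → d * (a + b + c) ≡ b * d + d * a + c * d
        expand = solve-∀
    w-deg : ∀ x → wdeg w x ≡ d x + A x
    w-deg x = begin
      sum (λ e → (c e + sum λ v → d v * mult (p v) e) * inc e x)
        ≡⟨ trans (sum-cong-≗ λ e → *-distribʳ-+ (inc e x) (c e) _) (∑-distrib-+ (λ e → c e * inc e x) _) ⟩
      d x + sum (λ e → (sum λ v → d v * mult (p v) e) * inc e x)
        ≡⟨ cong (d x +_) (sum-cong-≗ λ e → *-distribʳ-sum (inc e x) (λ v → d v * mult (p v) e)) ⟩
      d x + sum (λ e → sum λ v → d v * mult (p v) e * inc e x)
        ≡⟨ cong (d x +_) (∑-comm λ e v → d v * mult (p v) e * inc e x) ⟩
      d x + sum (λ v → sum λ e → d v * mult (p v) e * inc e x)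
        ≡⟨ cong (d x +_) (sum-cong-≗ λ v → trans (sum-cong-≗ λ e → *-assoc (d v) (mult (p v) e) (inc e x)) (sym (*-distribˡ-sum (d v) λ e → mult (p v) e * inc e x))) ⟩
      d x + A x ∎
      where open ≡-Reasoning
    K-even : ∀ x → Even (wdeg K x)
    K-even x = even-cancel (wdeg w x) (subst Even (sym (w-deg x)) (A-even x))
      (subst Even (trans (sum-cong-≗ λ e → *-distribʳ-+ (inc e x) (K e) (w e)) (∑-distrib-+ (λ e → K e * inc e x) _))
        (even-sum λ e → subst Even (*-comm (inc e x) _) (even-* (inc e x) (even-residue (w e)))))

  -- Growing a trail until it is closed and meets every vertex

  Trail : ∀ {P u v} → Conn P u v → Set
  Trail c = ∀ x → mult c x ≤ 1

  on : ∀ {P u v} → Conn P u v → Fin n → ℕ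
  on {v = v} c x = starts c x + ⟦ v ≟ x ⟧

  mult-◅◅ : ∀ {P u v w} (c : Conn P u v) (c′ : Conn P v w) x → mult (c ◅◅ c′) x ≡ mult c x + mult c′ x
  mult-◅◅ ε c′ x = refl
  mult-◅◅ ((e , _) ◅ c) c′ x = trans (cong (⟦ e ≟ x ⟧ +_) (mult-◅◅ c c′ x)) (sym (+-assoc ⟦ e ≟ x ⟧ _ _))

  split : ∀ {P u v} (c : Conn P u v) {y} → 1 ≤ on c y →
          ∃ λ (c₁ : Conn P u y) → ∃ λ (c₂ : Conn P y v) → ∀ x → mult c x ≡ mult c₁ x + mult c₂ x
  split {v = v} ε {y} l with v ≟ y
  ... | yes refl = ε , ε , λ _ → refl
  split {u = u} (s ◅ c) {y} l with u ≟ y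
  ... | yes refl = ε , s ◅ c , λ _ → refl
  ... | no _ with split c l
  ...   | c₁ , c₂ , eq = s ◅ c₁ , c₂ , λ x → trans (cong (⟦ proj₁ s ≟ x ⟧ +_) (eq x)) (sym (+-assoc ⟦ proj₁ s ≟ x ⟧ _ _))

  on-start : ∀ {P u v} (c : Conn P u v) → 1 ≤ on c u
  on-start {u = u} ε = ≤-reflexive (sym (⟦⟧-yes (u ≟ u) refl))
  on-start {u = u} (s ◅ c) = ≤-trans (≤-trans (≤-reflexive (sym (⟦⟧-yes (u ≟ u) refl))) (m≤m+n _ _)) (m≤m+n _ _)

  on-step : ∀ {P u v w} (s : Adj P u v) (c : Conn P v w) x → on c x ≤ on (s ◅ c) x
  on-step {u = u} s c x = +-monoˡ-≤ _ (m≤n+m (starts c x) ⟦ u ≟ x ⟧)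

  on-ends : ∀ {P u v} (c : Conn P u v) {e a b} → Joins G e a b → 1 ≤ mult c e → 1 ≤ on c b
  on-ends (_◅_ {j = w} (e′ , p , j) c) {e} {a} {b} ab l with e′ ≟ e
  ... | no _ = ≤-trans (on-ends c ab l) (on-step (e′ , p , j) c b)
  ... | yes refl with Joins-ends ab j
  ...   | inj₁ (_ , refl) = ≤-trans (on-start c) (on-step (e′ , p , j) c b)
  ...   | inj₂ (refl , _) = on-start ((e′ , p , j) ◅ c)

  exit-edge : ∀ {P u v} (c : Conn P u v) {y x} → Conn P y x → 1 ≤ on c y → ¬ 1 ≤ on c x →
              ∃ λ e → ∃ λ a → ∃ λ b → P e × Joins G e b a × 1 ≤ on c a × ¬ 1 ≤ on c b
  exit-edge c ε oy ¬ox = contradiction oy ¬ox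
  exit-edge c (_◅_ {i = y} {j = z} (e , p , j) rest) oy ¬ox with 1 ≤? on c z
  ... | yes oz = exit-edge c rest oz ¬ox
  ... | no ¬oz = e , y , z , p , swap j , oy , ¬oz

  Trail-◅ : ∀ {P u v w} {s : Adj P u v} {c : Conn P v w} → Trail c → mult c (proj₁ s) ≡ 0 → Trail (s ◅ c)
  Trail-◅ {s = s} {c} t z x with proj₁ s ≟ x
  ... | yes refl = ≤-reflexive (cong suc z)
  ... | no _     = t x

  module _ {P : Fin m → Set} (P? : Decidable P) (con : ∀ u v → Conn P u v)
    (balanced : ∀ x → Even (wdeg (λ e → ⟦ P? e ⟧) x)) where

    extend-open : ∀ {u v} (c : Conn P u v) → Trail c → u ≢ v → ∃ λ e → ∃ λ y → P e × Joins G e y u × mult c e ≡ 0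
    extend-open {u} {v} c t u≢v with any? (λ e → P? e ×-dec (mult c e ℕ.≟ 0) ×-dec ((proj₁ (ends e) ≟ u) ⊎-dec (proj₂ (ends e) ≟ u)))
    ... | yes (e , p , z , inj₁ refl) = e , _ , p , inj₂ refl , z
    ... | yes (e , p , z , inj₂ refl) = e , _ , p , inj₁ refl , z
    ... | no none = contradiction odd ¬even-1
      where
      all-used : ∀ e → mult c e * inc e u ≡ ⟦ P? e ⟧ * inc e u
      all-used e with P? e | mult c e in eq
      ... | no ¬p | k = cong (_* inc e u) (trans (sym eq) (mult-∉ c ¬p))
      ... | yes p | suc zero = refl
      ... | yes p | suc (suc k) = contradiction (subst (_≤ 1) eq (t e)) λ { (s≤s ()) }
      ... | yes p | zero = trans (sym (*-zeroʳ 0)) (sym (trans (+-identityʳ _) (cong₂ _+_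
        (⟦⟧-no (proj₁ (ends e) ≟ u) λ q → none (e , p , eq , inj₁ q)) (⟦⟧-no (proj₂ (ends e) ≟ u) λ q → none (e , p , eq , inj₂ q)))))
      odd : Even 1
      odd = even-cancel (wdeg (mult c) u) (subst Even (sym (sum-cong-≗ all-used)) (balanced u))
        (subst Even (trans (sym (+-identityʳ _)) (trans (cong₂ (λ a b → a + b) (refl {x = 2 * starts c u}) (sym (⟦⟧-no (v ≟ u) (u≢v ∘ sym))))
          (trans (sym (walk-degree c u)) (trans (cong (wdeg (mult c) u +_) (⟦⟧-yes (u ≟ u) refl)) (+-comm _ 1)))))
          (subst Even (cong (starts c u +_) (sym (+-identityʳ _))) (even-double (starts c u))))

    -- An open trail is extended at its start. A closed one that misses a vertex is rotated to begin
    -- at a vertex with a `P`-edge to a missed vertex, and this edge is put in front. `k` is fuel: a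
    -- trail has at most `m` edges.
    closed-trail : ∀ k {u v} (c : Conn P u v) → Trail c → m ≤ k + sum (mult c) →
                   ∃ λ u → ∃ λ (c : Conn P u u) → Trail c × ∀ x → 1 ≤ on c x
    closed-trail k {u} {v} c t le = by-ends (u ≟ v)
      where
      Result : Set
      Result = ∃ λ u → ∃ λ (c : Conn P u u) → Trail c × ∀ x → 1 ≤ on c x
      longer : ∀ k {x y z} {c : Conn P y z} → m ≤ k + sum (mult c) → Trail c → (s : Adj P x y) → mult c (proj₁ s) ≡ 0 → Result
      longer k {c = c} le t s z = go k le
        where
        t′ : Trail (s ◅ c)
        t′ = Trail-◅ {s = s} {c} t z
        length : sum (mult (s ◅ c)) ≡ suc (sum (mult c))
        length = trans (∑-distrib-+ (λ x → ⟦ proj₁ s ≟ x ⟧) _) (cong (_+ sum (mult c)) (sum-δ′ (proj₁ s)))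
        go : ∀ k → m ≤ k + sum (mult c) → Result
        go zero le = contradiction (≤-trans (≤-reflexive (sym length)) (≤-trans (≤-trans (sum-mono t′) (≤-reflexive (sum-one m))) le)) (<-irrefl refl)
        go (suc k) le = closed-trail k (s ◅ c) t′ (≤-trans le (≤-reflexive (trans (sym (+-suc k _)) (cong (k +_) (sym length)))))
      by-ends : Dec (u ≡ v) → Result
      by-ends (no u≢v) = let e , y , p , j , z = extend-open c t u≢v in longer k {c = c} le t (e , p , j) z
      by-ends (yes refl) with any? (λ x → ¬? (1 ≤? on c x))
      ... | no none = u , c , t , λ x → decidable-stable (1 ≤? on c x) λ ¬ox → none (x , ¬ox)
      ... | yes (x , ¬ox) with exit-edge c (con u x) (on-start c) ¬ox
      ...   | e , a , b , p , j , oa , ¬ob with split c oa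
      ...     | c₁ , c₂ , eq = longer k {c = c₂ ◅◅ c₁} (≤-trans le (≤-reflexive (cong (k +_) (sym (sum-cong-≗ rotated))))) (λ x → ≤-trans (≤-reflexive (rotated x)) (t x)) (e , p , j)
                (trans (rotated e) (n<1⇒n≡0 (≰⇒> λ l → ¬ob (on-ends c (swap j) l))))
        where
        rotated : ∀ x → mult (c₂ ◅◅ c₁) x ≡ mult c x
        rotated x = trans (mult-◅◅ c₂ c₁ x) (trans (+-comm (mult c₂ x) _) (sym (eq x)))

  -- From closed walks to `ClosedTrail`

  len : ∀ {P u v} → Conn P u v → ℕ
  len ε       = 0
  len (_ ◅ c) = suc (len c)

  vertAt : ∀ {P u v} (c : Conn P u v) → Fin (suc (len c)) → Fin n
  vertAt {u = u} c       zero    = u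
  vertAt         (s ◅ c) (suc i) = vertAt c i

  edgeAt : ∀ {P u v} (c : Conn P u v) → Fin (len c) → Fin m
  edgeAt (s ◅ c) zero    = proj₁ s
  edgeAt (s ◅ c) (suc i) = edgeAt c i

  joinsAt : ∀ {P u v} (c : Conn P u v) i → Joins G (edgeAt c i) (vertAt c (inject₁ i)) (vertAt c (suc i))
  joinsAt ((_ , _ , j) ◅ c) zero    = j
  joinsAt (s ◅ c)           (suc i) = joinsAt c i

  vertAt-last : ∀ {P u v} (c : Conn P u v) → vertAt c (fromℕ (len c)) ≡ v
  vertAt-last ε       = refl
  vertAt-last (s ◅ c) = vertAt-last c

  starts-sum : ∀ {P u v} (c : Conn P u v) x → sum (λ i → ⟦ vertAt c (inject₁ i) ≟ x ⟧) ≡ starts c x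
  starts-sum ε x = refl
  starts-sum (_◅_ {i = u} s c) x = cong (⟦ u ≟ x ⟧ +_) (starts-sum c x)

  edgeAt-used : ∀ {P u v} (c : Conn P u v) i → 1 ≤ mult c (edgeAt c i)
  edgeAt-used (s ◅ c) zero    = ≤-trans (≤-reflexive (sym (⟦⟧-yes (proj₁ s ≟ proj₁ s) refl))) (m≤m+n _ _)
  edgeAt-used (s ◅ c) (suc i) = ≤-trans (edgeAt-used c i) (m≤n+m _ _)

  edgeAt-injective : ∀ {P u v} (c : Conn P u v) → Trail c → ∀ {i j} → edgeAt c i ≡ edgeAt c j → i ≡ j
  edgeAt-injective (s ◅ c) t {zero}  {zero}  eq = refl
  edgeAt-injective (s ◅ c) t {suc i} {suc j} eq = cong suc (edgeAt-injective c (λ x → ≤-trans (m≤n+m _ _) (t x)) eq)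
  edgeAt-injective (s ◅ c) t {zero}  {suc j} eq = ⊥-elim (trail-fresh s c t j eq)
    where
    trail-fresh : ∀ {P u v w} (s : Adj P u v) (c : Conn P v w) → Trail (s ◅ c) → ∀ j → proj₁ s ≢ edgeAt c j
    trail-fresh s c t j eq = <-irrefl refl (≤-trans
      (+-mono-≤ (≤-reflexive (sym (⟦⟧-yes (proj₁ s ≟ edgeAt c j) eq))) (edgeAt-used c j)) (t (edgeAt c j)))
  edgeAt-injective (s ◅ c) t {suc i} {zero}  eq = sym (edgeAt-injective (s ◅ c) t {zero} {suc i} (sym eq))

  closedTrail : ∀ {P u w} (s : Adj P u w) (c : Conn P w u) → Trail (s ◅ c) → ClosedTrail G
  -- `inject₁` drops the last vertex of the walk, which repeats the first; what remains are the
  -- positions counted by `starts`.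
  closedTrail {P} {u} s c t = cyclic (len c) (vertAt (s ◅ c) ∘ inject₁) (edgeAt (s ◅ c)) (edgeAt-injective (s ◅ c) t)
    λ i → subst (Joins G (edgeAt (s ◅ c) i) (vertAt (s ◅ c) (inject₁ i))) (wrap i (toℕ i ℕ.≟ len c)) (joinsAt (s ◅ c) i)
    where
    k = len c
    toℕ-next : ∀ i → toℕ (next G {k} i) ≡ suc (toℕ i) % suc k
    toℕ-next i = toℕ-fromℕ< _
    -- Only the last index is special: there `next` returns to 0, and the walk has come back to `u`.
    wrap : ∀ i → Dec (toℕ i ≡ k) → vertAt c i ≡ vertAt (s ◅ c) (inject₁ (next G {k} i))
    wrap i (no i≢k) = cong (vertAt (s ◅ c)) (toℕ-injective {i = suc i} {j = inject₁ (next G {k} i)}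
      (sym (trans (toℕ-inject₁ _) (trans (toℕ-next i) (m<n⇒m%n≡m (s≤s (≤∧≢⇒< (s≤s⁻¹ (toℕ<n i)) i≢k)))))))
    wrap i (yes i≡k) = begin
      vertAt c i                       ≡⟨ cong (vertAt c) (toℕ-injective (trans i≡k (sym (toℕ-fromℕ k)))) ⟩
      vertAt c (fromℕ k)               ≡⟨ vertAt-last c ⟩
      u                                ≡⟨ cong (vertAt (s ◅ c) ∘ inject₁) (toℕ-injective {i = next G {k} i} {j = zero} (trans (toℕ-next i) (trans (cong (λ y → suc y % suc k) i≡k) (n%n≡0 (suc k))))) ⟨
      vertAt (s ◅ c) (inject₁ (next G {k} i)) ∎
      where open ≡-Reasoning

  closedTrail-visits : ∀ {P u w} (s : Adj P u w) (c : Conn P w u) (t : Trail (s ◅ c)) v → visits G (closedTrail s c t) v ≡ starts (s ◅ c) v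
  closedTrail-visits s c t v = trans (card-tabulate (λ i → ⌊ vertAt (s ◅ c) (inject₁ i) ≟ v ⌋))
    (trans (sum-cong-≗ λ i → cong (if_then 1 else 0) (isYes≗does (vertAt (s ◅ c) (inject₁ i) ≟ v))) (starts-sum (s ◅ c) v))

  -- Finite search over colourings and the conclusion

  colouring : Subset m → Subset m → Colouring
  colouring S₀ S₁ e = if does (e ∈? S₀) then just zero else if does (e ∈? S₁) then just (suc zero) else nothing

  -- Up to pointwise equality there are only finitely many colourings, coded by pairs of subsets;
  -- this makes an exhaustive search possible.
  colouring-cols : ∀ χ e → χ e ≡ colouring (subset (Col? χ zero)) (subset (Col? χ (suc zero))) e
  colouring-cols χ e with e ∈? subset (Col? χ zero) | e ∈? subset (Col? χ (suc zero)) | colour χ e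
  ... | yes e∈ | _      | _ = ∈-subset⁻ (Col? χ zero) e∈
  ... | no _   | yes e∈ | _ = ∈-subset⁻ (Col? χ (suc zero)) e∈
  ... | no _   | no _   | inj₁ eq = eq
  ... | no e∉  | no _   | inj₂ (zero , eq) = contradiction (∈-subset⁺ (Col? χ zero) eq) e∉
  ... | no _   | no e∉  | inj₂ (suc zero , eq) = contradiction (∈-subset⁺ (Col? χ (suc zero)) eq) e∉

  tree-colouring : (tc : TreeConnected G 2 ⊤) → Trees (colouring (proj₁ tc zero) (proj₁ tc (suc zero)))
  tree-colouring (F , tree , disjoint) i = (λ u v → Conn-map (coloured i) (Reach⇒Conn (proj₁ (proj₂ (tree i)) u v ∈⊤ ∈⊤))) ,
    trans (cong (_+ 1) (trans (sum-cong-≗ λ e → ⟦⟧-cong (Col? χ i e) (e ∈? F i) (member i) (coloured i)) (sym (card (F i)))))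
      (trans (proj₂ (proj₂ (tree i))) (∣⊤∣≡n n))
    where
    χ = colouring (F zero) (F (suc zero))
    coloured : ∀ i {e} → e ∈ F i → Col χ i e
    coloured zero {e} e∈ with e ∈? F zero
    ... | yes _ = refl
    ... | no e∉ = contradiction e∈ e∉
    coloured (suc zero) {e} e∈ with e ∈? F zero | e ∈? F (suc zero)
    ... | yes e∈′ | _     = contradiction e∈ (disjoint zero (suc zero) (λ ()) e e∈′)
    ... | no _    | yes _ = refl
    ... | no _    | no e∉ = contradiction e∈ e∉
    member : ∀ i {e} → Col χ i e → e ∈ F i
    member i {e} c with e ∈? F zero | e ∈? F (suc zero)
    member zero       c | yes e∈ | _      = e∈
    member (suc zero) c | no _   | yes e∈ = e∈
    member zero       () | no _  | yes _
    member (suc zero) () | yes _ | _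
    member i          () | no _  | no _

  module _ (f : Fin n → ℕ) (f≥1 : ∀ v → 1 ≤ f v) where

    Sparse : Colouring → Set
    Sparse χ = (∀ i u v → Conn (Col χ i) u v) × ∀ v → deg χ v ≤ suc (2 * f v)

    sparse? : ∀ χ → Dec (Sparse χ)
    sparse? χ = all? (λ i → all? λ u → all? λ v → Conn? (Col? χ i) u v) ×-dec all? (λ v → deg χ v ≤? suc (2 * f v))

    spanning-trail : ∀ {χ} → Sparse χ → Fin n → ∃ λ (T : ClosedTrail G) → Spanning G T × (∀ v → visits G T v ≤ f v)
    spanning-trail {χ} (con , sparse) r with even-subgraph con r
    ... | K , K-tree , K≤ , K-even = finish (closed-trail P? (λ u v → Conn-map K-tree (con zero u v))
            (λ x → subst Even (sum-cong-≗ λ e → cong (_* inc e x) (sym (K-indicator e))) (K-even x)) m {r} ε (λ _ → z≤n) (m≤m+n m _))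
      where
      P : Fin m → Set
      P e = K e ≡ 1
      P? : Decidable P
      P? e = K e ℕ.≟ 1
      used≤1 : ∀ c → used c ≤ 1
      used≤1 nothing  = z≤n
      used≤1 (just _) = ≤-refl
      K-indicator : ∀ e → ⟦ P? e ⟧ ≡ K e
      K-indicator e with K e | ≤-trans (K≤ e) (used≤1 (χ e))
      ... | zero        | _ = refl
      ... | suc zero    | _ = refl
      ... | suc (suc _) | s≤s ()
      finish : (∃ λ u → ∃ λ (c : Conn P u u) → Trail c × ∀ x → 1 ≤ on c x) → ∃ λ (T : ClosedTrail G) → Spanning G T × (∀ v → visits G T v ≤ f v)
      -- An empty walk meets every vertex only if `u` is the sole vertex. It is then visited once,
      -- which `f≥1` permits.
      finish (u , ε , _ , everywhere) = trivial u , spans , λ v → ≤-trans (∣p∣≤n (tabulate {n = 1} λ _ → ⌊ u ≟ v ⌋)) (f≥1 v)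
        where
        spans : ∀ v → 1 ≤ visits G (trivial u) v
        spans v with u ≟ v | everywhere v
        ... | yes _ | _ = ≤-refl
        ... | no _  | ()
      finish (u , s ◅ c , t , everywhere) = closedTrail s c t ,
        (λ v → subst (1 ≤_) (sym (closedTrail-visits s c t v)) (visited v)) , λ v → subst (_≤ f v) (sym (closedTrail-visits s c t v)) (few v)
        where
        visited : ∀ v → 1 ≤ starts (s ◅ c) v
        visited v with u ≟ v | everywhere v
        ... | yes _ | _ = s≤s z≤n
        ... | no _  | l = subst (1 ≤_) (+-identityʳ _) l
        few : ∀ v → starts (s ◅ c) v ≤ f v
        -- Twice the number of visits is the degree in the trail, hence at most 2 f + 1; by parity
        -- the spare unit is lost.
        few v = s≤s⁻¹ (*-cancelˡ-< 2 (starts (s ◅ c) v) (suc (f v)) (begin-strict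
          2 * starts (s ◅ c) v ≡⟨ +-cancelʳ-≡ ⟦ u ≟ v ⟧ _ _ (walk-degree (s ◅ c) v) ⟨
          wdeg (mult (s ◅ c)) v ≤⟨ sum-mono (λ e → *-monoˡ-≤ (inc e v) (mult≤used e)) ⟩
          deg χ v              ≤⟨ sparse v ⟩
          suc (2 * f v)        <⟨ ≤-reflexive (sym (*-suc 2 (f v))) ⟩
          2 * suc (f v)        ∎))
          where
          open ≤-Reasoning
          mult≤used : ∀ e → mult (s ◅ c) e ≤ used (χ e)
          mult≤used e with P? e
          ... | yes p = ≤-trans (t e) (≤-trans (≤-reflexive (sym p)) (K≤ e))
          ... | no ¬p = ≤-trans (≤-reflexive (mult-∉ (s ◅ c) ¬p)) z≤n

    -- The double negation ends here: `Sparse` is decidable, and all pairs of subsets can be tried.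
    sparse-exists : ¬ ¬ (∃ λ χ → Sparse χ) → ∃ λ χ → Sparse χ
    sparse-exists ¬¬s with anySubset? (λ S₀ → anySubset? λ S₁ → sparse? (colouring S₀ S₁))
    ... | yes (S₀ , S₁ , s) = colouring S₀ S₁ , s
    ... | no none = ⊥-elim (¬¬s λ (χ , con , sparse) → none (_ , _ ,
            (λ i u v → Conn-map (λ {e} c → trans (sym (colouring-cols χ e)) c) (con i u v)) ,
            λ v → ≤-trans (≤-reflexive (sum-cong-≗ λ e → cong (λ c → used c * inc e v) (sym (colouring-cols χ e)))) (sparse v)))

theorem1p6 : (G : Graph) (f : Fin (Graph.n G) → ℕ) →
    (∀ v → 1 ≤ f v) →
    TreeConnected G 2 ⊤ →
    (∀ (S : Subset (Graph.n G)) (P : ComponentPartition G 2 (∁ S)) →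
    Ω G P ℤ.≤ sumOver G S (λ v → ℤ.+ 2 ℤ.* ℤ.+ f v ℤ.- ℤ.+ 3) ℤ.+ ℤ.+ 4) →
    ∃ λ (T : ClosedTrail G) → Spanning G T × (∀ v → visits G T v ≤ f v)
-- A root exists because the number of vertices is the size of a tree plus 1.
theorem1p6 G f f≥1 tc condition = spanning-trail f f≥1 (proj₂ sparse) (fromℕ< (subst (0 <_) (proj₂ (T zero)) (m≤n+m 1 _)))
  where
  open Multigraph G
  open Existence f condition using (good-exists)
  T = tree-colouring tc
  sparse = sparse-exists f f≥1 λ none → good-exists _ T ≤-refl λ (χ , T′ , d) → none (χ , (λ i → proj₁ (T′ i)) , d)
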